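{- Let $G=(V,E)$ be a finite graph, let $A,B\subseteq E$ be chosen independently and uniformly at random and let $\Delta$ be the event that $A\bigtriangleup B$ is eulerian. Then $$\mathrm{Bias}(|A|\equiv |B|+1\ (\mathrm{mod}\ 3)\mid\Delta)=\mathrm{Bias}(|A|\equiv|B|+2\ (\mathrm{mod}\ 3)\mid\Delta)$$ and $$\frac{\mathrm{Bias}(|A|\equiv |B|\ (\mathrm{mod}\ 3)\mid\Delta)-\mathrm{Bias}(|A|\equiv |B|+1\ (\mathrm{mod}\ 3)\mid\Delta)}{\mathrm{Bias}(|A|\equiv |B|\ (\mathrm{mod}\ 3))-\mathrm{Bias}(|A|\equiv |B|+1\ (\mathrm{mod}\ 3))}=(-2)^{r(G)}3^{n(G)}\,T\!\left(G;-2,\tfrac{1}{3}\right).$$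
   Context: Graphs are finite; loops and parallel edges are permitted. A subset $A\subseteq E$ is identified with the subgraph $(V,A)$ of $G$; it is called eulerian if all its vertex degrees are even (a loop contributes 2 to the degree). $\bigtriangleup$ is symmetric difference of sets. For $A\subseteq E$, $r(A)=|V|-k(A)$, where $k(A)$ is the number of connected components of $(V,A)$; $r(G)=r(E)$ and $n(G)=|E|-r(G)$. The Tutte polynomial is $T(G;x,y)=\sum_{A\subseteq E}(x-1)^{r(E)-r(A)}(y-1)^{|A|-r(A)}$. For an event $\Sigma$, $\mathrm{Bias}(\Sigma)=\mathbb{P}(\Sigma)-\mathbb{P}(\overline{\Sigma})$ and $\mathrm{Bias}(\Sigma\mid\Delta)=\mathbb{P}(\Sigma\mid\Delta)-\mathbb{P}(\overline{\Sigma}\mid\Delta)$, where $\overline{\Sigma}$ is the complement of $\Sigma$. -}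

module Defs where

open import Level using (0ℓ)
open import Data.Bool.Base using (false; if_then_else_; _xor_)
import Data.Bool.Properties as Bool
open import Data.Fin.Base using (Fin; zero; suc)
open import Data.Fin.Properties using (_≟_; all?)
open import Data.Fin.Subset using (Subset; inside; outside; _∈_; ∣_∣; ⊥; ⊤)
open import Data.Integer.Base using (+_)
open import Data.List.Base as List
  using (List; []; _∷_; _++_; length; filter; allFin; cartesianProduct; deduplicate)
open import Data.List.Membership.Propositional using () renaming (_∈_ to _∈ₗ_)
open import Data.List.Membership.Propositional.Properties
  using (∈-map⁺; ∈-++⁺ˡ; ∈-++⁺ʳ; ∈-filter⁺; ∈-cartesianProduct⁺)
open import Data.List.Relation.Unary.Any using (here; there)
open import Data.Nat.Base as ℕ using (ℕ; zero; suc; _∸_)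
open import Data.Nat.Divisibility using (_∣_; _∣?_; _∣0)
open import Data.Nat.DivMod using (_%_)
open import Data.Nat.ListAction using (sum)
import Data.Nat.Properties as ℕ
open import Data.Product.Base using (∃; _×_; _,_; proj₁; proj₂)
open import Data.Rational.Base as ℚ using (ℚ; 0ℚ; 1ℚ; _+_; _*_; _-_; _÷_; _/_)
import Data.Rational.Properties as ℚ
open import Data.Sum.Base using (_⊎_; inj₁; inj₂)
open import Data.Vec.Base as Vec using ([]; _∷_; lookup; zipWith; tabulate)
import Data.Vec.Properties as Vec
open import Function.Base using (_∘_)
open import Relation.Binary.Core using (Rel)
open import Relation.Binary.Construct.Closure.Equivalence as Eq using (EqClosure)
open import Relation.Binary.Construct.Closure.ReflexiveTransitive using (ε; _◅_; _◅◅_)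
open import Relation.Binary.Construct.Closure.Symmetric using (fwd; bwd)
open import Relation.Binary.PropositionalEquality
  using (_≡_; refl; sym; subst)
open import Relation.Nullary.Decidable using (Dec; does; map′; _×-dec_; _⊎-dec_)
open import Relation.Unary using (Pred; Decidable)
open import Relation.Unary.Properties using (∁?; _∩?_)

open import Algebra.Definitions.RawSemiring ℚ.+-*-rawSemiring public using (_^_)

-- The order of the two ends of an edge carries no meaning.  Distinct edges
-- may have the same ends, and the two ends may coincide (a loop).
record Graph : Set where
  field
    order : ℕ
    size  : ℕ
    ends  : Fin size → Fin order × Fin order

  Vertex : Set
  Vertex = Fin order

  Edge : Set
  Edge = Fin size

  EdgeSet : Set
  EdgeSet = Subset size

infixl 5 _△_
_△_ : ∀ {n} → Subset n → Subset n → Subset n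
_△_ = zipWith _xor_

module _ {v m : ℕ} (ends : Fin m → Fin v × Fin v) where

  Adjacent : Subset m → Rel (Fin v) 0ℓ
  Adjacent A u w = ∃ λ e → e ∈ A × ends e ≡ (u , w)

  Connected : Subset m → Rel (Fin v) 0ℓ
  Connected A = EqClosure (Adjacent A)

private
  module _ {v m : ℕ} (ends : Fin (suc m) → Fin v × Fin v) (A : Subset m) where

    rest : Fin m → Fin v × Fin v
    rest = ends ∘ suc

    p q : Fin v
    p = proj₁ (ends zero)
    q = proj₂ (ends zero)

    grow : ∀ {s u w} → Connected rest A u w → Connected ends (s ∷ A) u w
    grow = Eq.map λ (e , e∈A , eq) → suc e , Vec.there e∈A , eq

    shrink : ∀ {u w} → Connected ends (outside ∷ A) u w → Connected rest A u w
    shrink = Eq.map λ { (suc e , Vec.there e∈A , eq) → e , e∈A , eq }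

    Via : Rel (Fin v) 0ℓ
    Via u w = Connected rest A u w
            ⊎ (Connected rest A u p × Connected rest A q w)
            ⊎ (Connected rest A u q × Connected rest A p w)

    pq : Connected ends (inside ∷ A) p q
    pq = Eq.return (zero , Vec.here , refl)

    via⇒ : ∀ {u w} → Via u w → Connected ends (inside ∷ A) u w
    via⇒ (inj₁ c)               = grow c
    via⇒ (inj₂ (inj₁ (c , d))) = grow c ◅◅ pq ◅◅ grow d
    via⇒ (inj₂ (inj₂ (c , d))) = grow c ◅◅ Eq.symmetric _ pq ◅◅ grow d

    prepend : ∀ {t u w} → Connected rest A t u → Via u w → Via t w
    prepend c (inj₁ d)               = inj₁ (c ◅◅ d)
    prepend c (inj₂ (inj₁ (d , d′))) = inj₂ (inj₁ (c ◅◅ d , d′))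
    prepend c (inj₂ (inj₂ (d , d′))) = inj₂ (inj₂ (c ◅◅ d , d′))

    p-via : ∀ {w} → Via q w → Via p w
    p-via (inj₁ c)              = inj₂ (inj₁ (ε , c))
    p-via (inj₂ (inj₁ (_ , c))) = inj₂ (inj₁ (ε , c))
    p-via (inj₂ (inj₂ (_ , c))) = inj₁ c

    q-via : ∀ {w} → Via p w → Via q w
    q-via (inj₁ c)              = inj₂ (inj₂ (ε , c))
    q-via (inj₂ (inj₁ (_ , c))) = inj₁ c
    q-via (inj₂ (inj₂ (_ , c))) = inj₂ (inj₂ (ε , c))

    ⇒via : ∀ {u w} → Connected ends (inside ∷ A) u w → Via u w
    ⇒via ε = inj₁ ε
    ⇒via (fwd (zero  , _ , refl) ◅ c) = p-via (⇒via c)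
    ⇒via (bwd (zero  , _ , refl) ◅ c) = q-via (⇒via c)
    ⇒via (fwd (suc e , Vec.there e∈A , eq) ◅ c) =
      prepend (Eq.return (e , e∈A , eq)) (⇒via c)
    ⇒via (bwd (suc e , Vec.there e∈A , eq) ◅ c) =
      prepend (Eq.symmetric _ (Eq.return (e , e∈A , eq))) (⇒via c)

connected? : ∀ {v m} (ends : Fin m → Fin v × Fin v) (A : Subset m) (u w : Fin v) →
             Dec (Connected ends A u w)
connected? ends [] u w = map′ (λ { refl → ε }) no-edges (u ≟ w)
  where
  no-edges : ∀ {u w} → Connected ends [] u w → u ≡ w
  no-edges ε                  = refl
  no-edges (fwd (() , _) ◅ _)
  no-edges (bwd (() , _) ◅ _)
connected? ends (outside ∷ A) u w =
  map′ (grow ends A) (shrink ends A) (connected? (ends ∘ suc) A u w)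
connected? ends (inside ∷ A) u w =
  map′ (via⇒ ends A) (⇒via ends A)
    (c? u w ⊎-dec (c? u (p ends A) ×-dec c? (q ends A) w)
            ⊎-dec (c? u (q ends A) ×-dec c? (p ends A) w))
  where c? = connected? (ends ∘ suc) A

subsets : ∀ n → List (Subset n)
subsets zero    = [] ∷ []
subsets (suc n) = List.map (outside ∷_) (subsets n) ++ List.map (inside ∷_) (subsets n)

∈-subsets : ∀ {n} (A : Subset n) → A ∈ₗ subsets n
∈-subsets []            = here refl
∈-subsets (outside ∷ A) = ∈-++⁺ˡ (∈-map⁺ (outside ∷_) (∈-subsets A))
∈-subsets (inside ∷ A)  = ∈-++⁺ʳ _ (∈-map⁺ (inside ∷_) (∈-subsets A))

∑ : {X : Set} → List X → (X → ℚ) → ℚ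
∑ xs f = List.foldr (λ x s → f x + s) 0ℚ xs

module _ (G : Graph) where
  open Graph G

  component : EdgeSet → Vertex → Subset order
  component A u = tabulate λ w → does (connected? ends A u w)

  components : EdgeSet → List (Subset order)
  components A = deduplicate (Vec.≡-dec Bool._≟_) (List.map (component A) (allFin order))

  k : EdgeSet → ℕ
  k A = length (components A)

  -- Here and below truncated subtraction never truncates:
  -- k A ≤ |V|, r A ≤ ∣ A ∣ and r A ≤ r E.
  r : EdgeSet → ℕ
  r A = order ∸ k A

  rank : ℕ
  rank = r ⊤

  nullity : ℕ
  nullity = size ∸ rank

  tutte : ℚ → ℚ → ℚ
  tutte x y = ∑ (subsets size) λ A →
    (x - 1ℚ) ^ (r ⊤ ∸ r A) * (y - 1ℚ) ^ (∣ A ∣ ∸ r A)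

  endCount : Edge → Vertex → ℕ
  endCount e w = let (a , b) = ends e in hits a ℕ.+ hits b
    where
    hits : Vertex → ℕ
    hits a = if does (a ≟ w) then 1 else 0

  degree : EdgeSet → Vertex → ℕ
  degree A w = sum (List.map (λ e → if lookup A e then endCount e w else 0) (allFin size))

  Eulerian : Pred EdgeSet 0ℓ
  Eulerian A = ∀ w → 2 ∣ degree A w

  eulerian? : Decidable Eulerian
  eulerian? A = all? λ w → 2 ∣? degree A w

-- Two independent uniform subsets of Fin n are the coordinates of a uniform
-- point of Ω n.
Ω : ℕ → Set
Ω n = Subset n × Subset n

outcomes : ∀ n → List (Ω n)
outcomes n = cartesianProduct (subsets n) (subsets n)

private
  ∈⇒nonZero : {X : Set} {x : X} {xs : List X} → x ∈ₗ xs → ℕ.NonZero (length xs)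
  ∈⇒nonZero (here _)  = _
  ∈⇒nonZero (there _) = _

∈-outcomes : ∀ {n} (ω : Ω n) → ω ∈ₗ outcomes n
∈-outcomes (A , B) = ∈-cartesianProduct⁺ (∈-subsets A) (∈-subsets B)

∣outcomes∣≢0 : ∀ n → ℕ.NonZero (length (outcomes n))
∣outcomes∣≢0 n = ∈⇒nonZero (∈-outcomes {n} (⊥ , ⊥))

module _ {n : ℕ} where

  ℙ : {P : Pred (Ω n) 0ℓ} → Decidable P → ℚ
  ℙ P? = ((+ length (filter P? (outcomes n))) / length (outcomes n)) {{∣outcomes∣≢0 n}}

  ℙ[_∣_] : {P Q : Pred (Ω n) 0ℓ} → Decidable P → (Q? : Decidable Q) →
           .{{ℚ.NonZero (ℙ Q?)}} → ℚ
  ℙ[ P? ∣ Q? ] = ℙ (P? ∩? Q?) ÷ ℙ Q?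

  Bias : {P : Pred (Ω n) 0ℓ} → Decidable P → ℚ
  Bias P? = ℙ P? - ℙ (∁? P?)

  Bias[_∣_] : {P Q : Pred (Ω n) 0ℓ} → Decidable P → (Q? : Decidable Q) →
              .{{ℚ.NonZero (ℙ Q?)}} → ℚ
  Bias[ P? ∣ Q? ] = ℙ[ P? ∣ Q? ] - ℙ[ ∁? P? ∣ Q? ]

  ℙ-nonZero : {P : Pred (Ω n) 0ℓ} (P? : Decidable P) (ω : Ω n) → P ω → ℚ.NonZero (ℙ P?)
  ℙ-nonZero P? ω Pω = ℚ.pos⇒nonZero (ℙ P?) {{ℚ.normalize-pos
    (length (filter P? (outcomes n))) (length (outcomes n))
    {{∣outcomes∣≢0 n}} {{∈⇒nonZero (∈-filter⁺ P? (∈-outcomes ω) Pω)}}}}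

  SizesDifferMod3 : ℕ → Pred (Ω n) 0ℓ
  SizesDifferMod3 i (A , B) = ∣ A ∣ % 3 ≡ (∣ B ∣ ℕ.+ i) % 3

  sizesDifferMod3? : ∀ i → Decidable (SizesDifferMod3 i)
  sizesDifferMod3? i (A , B) = ∣ A ∣ % 3 ℕ.≟ (∣ B ∣ ℕ.+ i) % 3

module _ (G : Graph) where
  open Graph G

  Δ : Pred (Ω size) 0ℓ
  Δ (A , B) = Eulerian G (A △ B)

  Δ? : Decidable Δ
  Δ? (A , B) = eulerian? G (A △ B)

  private
    lookup-⊥△⊥ : ∀ {n} (e : Fin n) → lookup (⊥ {n} △ ⊥) e ≡ false
    lookup-⊥△⊥ zero    = refl
    lookup-⊥△⊥ (suc e) = lookup-⊥△⊥ e

    degree-⊥△⊥ : ∀ w (es : List Edge) →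
      sum (List.map (λ e → if lookup (⊥ {size} △ ⊥) e then endCount G e w else 0) es) ≡ 0
    degree-⊥△⊥ w []       = refl
    degree-⊥△⊥ w (e ∷ es) rewrite lookup-⊥△⊥ e = degree-⊥△⊥ w es

  ℙΔ≢0 : ℚ.NonZero (ℙ Δ?)
  ℙΔ≢0 = ℙ-nonZero Δ? (⊥ , ⊥) λ w →
    subst (2 ∣_) (sym (degree-⊥△⊥ w (allFin size))) (2 ∣0)

  Bias[_∣Δ] : {P : Pred (Ω size) 0ℓ} → Decidable P → ℚ
  Bias[ P? ∣Δ] = Bias[ P? ∣ Δ? ] {{ℙΔ≢0}}

{-# OPTIONS --safe #-}
-- Fixing C = A △ B, the differences ∣ A ∣ - ∣ B ∣ contribute ω + ω⁻¹ = -1 for each edge of C and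
-- 2 for each other edge, so that the quotient of biases is ∑ 2^(m-∣C∣) (-1)^∣C∣ over eulerian C,
-- divided by ℙ(Δ) = 2^(-r(G)).  Summing the parity characters of all two-colourings σ of the
-- vertices turns a sum of edge weights over eulerian sets into ∑_σ ∏_e (f e + g e σ(p) σ(q)).
-- Writing 1 + σ(p) σ(q) = 2 [σ(p) = σ(q)] and expanding the product gives a sum over all A ⊆ E of
-- an edge weight times the number 2^k(A) of two-colourings constant on the components of A, which
-- is T(G; -2, 1/3), a point of the hyperbola (x - 1)(y - 1) = 2, up to a prefactor.

module Submission where

open import Data.Bool.Base using (Bool; true; false; if_then_else_)
import Data.Bool.Properties as Bool
open import Data.Fin.Base using (Fin; zero; suc)
import Data.Fin.Properties as Fin
open import Data.Fin.Subset using (Subset; inside; outside; ∣_∣; ⊥; ⊤)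
open import Data.Fin.Subset.Properties using (∣⊤∣≡n; ∈⊤)
open import Data.Integer.Base as ℤ using (+_; -[1+_])
import Data.Integer.Properties as ℤ
open import Data.List.Base as List
  using (List; []; _∷_; _++_; length; filter; allFin; cartesianProduct; deduplicate)
open import Data.List.Membership.Propositional using () renaming (_∈_ to _∈ₗ_)
open import Data.List.Membership.Propositional.Properties
  using (∈-deduplicate⁺; ∈-deduplicate⁻; ∈-tabulate⁺; ∈-tabulate⁻)
open import Data.List.Properties
  using (filter-all; length-deduplicate; length-map; length-tabulate; map-tabulate)
import Data.List.Relation.Unary.All as All
open import Data.List.Relation.Unary.AllPairs using (_∷_)
open import Data.List.Relation.Unary.Any using (here; there)
open import Data.List.Relation.Unary.Unique.Propositional using (Unique)
open import Data.List.Relation.Unary.Unique.DecPropositional.Properties using (deduplicate-!)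
open import Data.Nat.Base as ℕ using (ℕ; zero; suc; z≤n; s≤s; _∸_)
open import Data.Nat.Divisibility using (_∣?_)
open import Data.Nat.DivMod using (_%_)
open import Data.Nat.ListAction using (sum)
import Data.Nat.Properties as ℕ
open import Data.Product.Base using (Σ; _×_; _,_; proj₁; proj₂)
open import Data.Rational.Base as ℚ
  using (ℚ; NonZero; Positive; 0ℚ; 1ℚ; _+_; _*_; _-_; -_; _÷_; _/_; 1/_; _≤_)
import Data.Rational.Properties as ℚ
open import Data.Rational.Solver using (module +-*-Solver)
open import Data.Rational.Unnormalised.Base as ℚᵘ using (mkℚᵘ)
import Data.Rational.Unnormalised.Properties as ℚᵘ
open import Data.Vec.Base as Vec using ([]; _∷_; lookup)
import Data.Vec.Properties as Vec
open import Function.Base using (_∘_; case_of_)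
open import Function.Bundles using (mk⇔)
open import Level using (Level; 0ℓ)
import Relation.Binary.Construct.Closure.Equivalence as Eq
open import Relation.Binary.Definitions using (DecidableEquality)
open import Relation.Binary.PropositionalEquality
  using (_≡_; _≢_; _≗_; refl; sym; trans; cong; cong₂; subst; subst₂; module ≡-Reasoning; isEquivalence)
open import Relation.Nullary.Decidable
  using (Dec; yes; no; does; _×-dec_; _→-dec_; ¬?; does-⇔; dec-true)
open import Relation.Nullary.Negation using (¬_; contradiction)
open import Relation.Unary using (Pred; Decidable)
open import Relation.Unary.Properties using (∁?; _∩?_)

import Algebra.Properties.CommutativeMonoid.Sum ℚ.*-1-commutativeMonoid as Prod
import Algebra.Properties.CommutativeSemiring.Exp as Exp
open import Algebra.Bundles using (CommutativeRing)
open Exp (CommutativeRing.commutativeSemiring ℚ.+-*-commutativeRing)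
  using (^-homo-*; ^-distrib-*)

open import Defs

open +-*-Solver using (solve; _:+_; _:*_; _:-_; :-_; _:=_; con)
open ≡-Reasoning

-- The sum over colourings is an Ising partition function. Its high-temperature expansion runs over
-- eulerian sets, its random-cluster expansion over all edge sets, and equating the two is what
-- brings in the Tutte polynomial. The number 2 of colours is why the point must lie on this
-- hyperbola: here (-3)(-2/3) = 2. The obstacle is less the algebra than the exponents. They are
-- truncated differences, so `k A ≤ |V|`, `r A ≤ |A|` and `r A ≤ r E` have to be proved for a `k`
-- that merely counts distinct membership vectors. The first bounds the length of a list. The other
-- two avoid adding edges one at a time: `2ℚ ^ k G A` counts colourings, the eulerian subsets of `A`
-- are counted by the same character sum, and inequalities between such counts yield inequalities
-- between their exponents. The counting identities carry `2ℚ ^ order` as a factor on the left in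
-- place of a division.

private
  variable
    ℓ : Level
    P Q : Set ℓ
    X Y : Set
    n : ℕ

-- Indicators of decidable propositions

2ℚ 3ℚ : ℚ
2ℚ = + 2 / 1
3ℚ = + 3 / 1

𝟙 : Dec P → ℚ
𝟙 P? = if does P? then 1ℚ else 0ℚ

𝟙-⇔ : (P → Q) → (Q → P) → (P? : Dec P) (Q? : Dec Q) → 𝟙 P? ≡ 𝟙 Q?
𝟙-⇔ to from P? Q? = cong (if_then 1ℚ else 0ℚ) (does-⇔ (mk⇔ to from) P? Q?)

𝟙-× : (P? : Dec P) (Q? : Dec Q) → 𝟙 (P? ×-dec Q?) ≡ 𝟙 P? * 𝟙 Q?
𝟙-× (yes _) Q? = sym (ℚ.*-identityˡ (𝟙 Q?))
𝟙-× (no _)  Q? = sym (ℚ.*-zeroˡ (𝟙 Q?))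

𝟙-¬ : (P? : Dec P) → 𝟙 (¬? P?) ≡ 1ℚ - 𝟙 P?
𝟙-¬ (yes _) = refl
𝟙-¬ (no _)  = refl

0≤𝟙 : (P? : Dec P) → 0ℚ ≤ 𝟙 P?
0≤𝟙 (yes _) = ℚ.nonNegative⁻¹ 1ℚ
0≤𝟙 (no _)  = ℚ.≤-refl

𝟙-mono : (P → Q) → (P? : Dec P) (Q? : Dec Q) → 𝟙 P? ≤ 𝟙 Q?
𝟙-mono f (yes p) (yes q) = ℚ.≤-refl
𝟙-mono f (yes p) (no ¬q) = contradiction (f p) ¬q
𝟙-mono f (no ¬p) Q?      = 0≤𝟙 Q?

-- Finite sums and products

∑-cong : {f g : X → ℚ} (xs : List X) → f ≗ g → ∑ xs f ≡ ∑ xs g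
∑-cong []       f≗g = refl
∑-cong (x ∷ xs) f≗g = cong₂ _+_ (f≗g x) (∑-cong xs f≗g)

∑-zero : (xs : List X) → ∑ xs (λ _ → 0ℚ) ≡ 0ℚ
∑-zero []       = refl
∑-zero (_ ∷ xs) = trans (ℚ.+-identityˡ _) (∑-zero xs)

∑-+ : (xs : List X) (f g : X → ℚ) → ∑ xs (λ x → f x + g x) ≡ ∑ xs f + ∑ xs g
∑-+ []       f g = refl
∑-+ (x ∷ xs) f g = trans (cong (_+_ (f x + g x)) (∑-+ xs f g))
  (solve 4 (λ a b c d → (a :+ b) :+ (c :+ d) := (a :+ c) :+ (b :+ d)) refl
         (f x) (g x) (∑ xs f) (∑ xs g))

*-∑ : (c : ℚ) (xs : List X) (f : X → ℚ) → ∑ xs (λ x → c * f x) ≡ c * ∑ xs f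
*-∑ c []       f = sym (ℚ.*-zeroʳ c)
*-∑ c (x ∷ xs) f = trans (cong (_+_ (c * f x)) (*-∑ c xs f)) (sym (ℚ.*-distribˡ-+ c _ _))

∑-- : (xs : List X) (f g : X → ℚ) → ∑ xs (λ x → f x - g x) ≡ ∑ xs f - ∑ xs g
∑-- []       f g = refl
∑-- (x ∷ xs) f g = trans (cong (_+_ (f x - g x)) (∑-- xs f g))
  (solve 4 (λ a b c d → (a :- b) :+ (c :- d) := (a :+ c) :- (b :+ d)) refl
         (f x) (g x) (∑ xs f) (∑ xs g))

∑-comm : (xs : List X) (ys : List Y) (f : X → Y → ℚ) →
         ∑ xs (λ x → ∑ ys (f x)) ≡ ∑ ys (λ y → ∑ xs (λ x → f x y))
∑-comm []       ys f = sym (∑-zero ys)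
∑-comm (x ∷ xs) ys f = trans (cong (_+_ (∑ ys (f x))) (∑-comm xs ys f))
  (sym (∑-+ ys (f x) (λ y → ∑ xs (λ x → f x y))))

∑-++ : (xs ys : List X) (f : X → ℚ) → ∑ (xs ++ ys) f ≡ ∑ xs f + ∑ ys f
∑-++ []       ys f = sym (ℚ.+-identityˡ _)
∑-++ (x ∷ xs) ys f = trans (cong (_+_ (f x)) (∑-++ xs ys f)) (sym (ℚ.+-assoc (f x) (∑ xs f) (∑ ys f)))

∑-map : (g : X → Y) (xs : List X) (f : Y → ℚ) → ∑ (List.map g xs) f ≡ ∑ xs (f ∘ g)
∑-map g []       f = refl
∑-map g (x ∷ xs) f = cong (_+_ (f (g x))) (∑-map g xs f)

∑-cartesianProduct : (xs : List X) (ys : List Y) (f : X × Y → ℚ) →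
                     ∑ (cartesianProduct xs ys) f ≡ ∑ xs (λ x → ∑ ys (λ y → f (x , y)))
∑-cartesianProduct []       ys f = refl
∑-cartesianProduct (x ∷ xs) ys f = trans (∑-++ (List.map (x ,_) ys) _ f)
  (cong₂ _+_ (∑-map (x ,_) ys f) (∑-cartesianProduct xs ys f))

∑-mono : {f g : X → ℚ} (xs : List X) → (∀ x → f x ≤ g x) → ∑ xs f ≤ ∑ xs g
∑-mono []       f≤g = ℚ.≤-refl
∑-mono (x ∷ xs) f≤g = ℚ.+-mono-≤ (f≤g x) (∑-mono xs f≤g)

0≤∑ : {f : X → ℚ} (xs : List X) → (∀ x → 0ℚ ≤ f x) → 0ℚ ≤ ∑ xs f
0≤∑ {f = f} xs 0≤f = subst (_≤ ∑ xs f) (∑-zero xs) (∑-mono {f = λ _ → 0ℚ} xs 0≤f)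

term≤∑ : {f : X → ℚ} {x : X} {xs : List X} → (∀ y → 0ℚ ≤ f y) → x ∈ₗ xs → f x ≤ ∑ xs f
term≤∑ {f = f} {xs = x ∷ xs} 0≤f (here refl) =
  subst (_≤ f x + ∑ xs f) (ℚ.+-identityʳ (f x)) (ℚ.+-monoʳ-≤ (f x) (0≤∑ xs 0≤f))
term≤∑ {f = f} {x} {y ∷ xs} 0≤f (there x∈xs) =
  subst (_≤ f y + ∑ xs f) (ℚ.+-identityˡ (f x)) (ℚ.+-mono-≤ (0≤f y) (term≤∑ 0≤f x∈xs))

∑-subsets : ∀ n (f : Subset (suc n) → ℚ) →
  ∑ (subsets (suc n)) f ≡ ∑ (subsets n) (f ∘ (outside ∷_)) + ∑ (subsets n) (f ∘ (inside ∷_))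
∑-subsets n f = trans (∑-++ (List.map (outside ∷_) (subsets n)) _ f)
  (cong₂ _+_ (∑-map (outside ∷_) (subsets n) f) (∑-map (inside ∷_) (subsets n) f))

∑-subsets-const : ∀ n c → ∑ (subsets n) (λ _ → c) ≡ 2ℚ ^ n * c
∑-subsets-const zero    c = trans (ℚ.+-identityʳ c) (sym (ℚ.*-identityˡ c))
∑-subsets-const (suc n) c = begin
  ∑ (subsets (suc n)) (λ _ → c)
    ≡⟨ ∑-subsets n (λ _ → c) ⟩
  ∑ (subsets n) (λ _ → c) + ∑ (subsets n) (λ _ → c)
    ≡⟨ cong₂ _+_ (∑-subsets-const n c) (∑-subsets-const n c) ⟩
  2ℚ ^ n * c + 2ℚ ^ n * c
    ≡⟨ solve 2 (λ t c → t :* c :+ t :* c := (con 2ℚ :* t) :* c) refl (2ℚ ^ n) c ⟩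
  2ℚ ^ suc n * c ∎

∏ : (Fin n → ℚ) → ℚ
∏ = Prod.sum

∏-cong : {f g : Fin n → ℚ} → f ≗ g → ∏ f ≡ ∏ g
∏-cong = Prod.sum-cong-≗

∏-* : (f g : Fin n → ℚ) → ∏ (λ i → f i * g i) ≡ ∏ f * ∏ g
∏-* = Prod.∑-distrib-+

∏-const : ∀ n c → ∏ {n} (λ _ → c) ≡ c ^ n
∏-const n c = Prod.sum-replicate n

∏-1 : ∀ n → ∏ {n} (λ _ → 1ℚ) ≡ 1ℚ
∏-1 = Prod.sum-replicate-zero

0≤∏ : {f : Fin n → ℚ} → (∀ i → 0ℚ ≤ f i) → 0ℚ ≤ ∏ f
0≤∏ {n = zero}      0≤f = ℚ.nonNegative⁻¹ 1ℚ
0≤∏ {n = suc n} {f} 0≤f = ℚ.nonNegative⁻¹ (f zero * ∏ (f ∘ suc))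
  {{ℚ.nonNeg*nonNeg⇒nonNeg (f zero) {{ℚ.nonNegative (0≤f zero)}}
                           (∏ (f ∘ suc)) {{ℚ.nonNegative (0≤∏ (0≤f ∘ suc))}}}}

-- Choosing one term from each of `n` binomials is choosing a subset. Read from left to right this
-- sums out independent choices; read backwards it expands a product.
∑-∏ : ∀ n (w : Fin n → Bool → ℚ) →
      ∑ (subsets n) (λ A → ∏ (λ i → w i (lookup A i))) ≡ ∏ (λ i → w i outside + w i inside)
∑-∏ zero    w = refl
∑-∏ (suc n) w = begin
  ∑ (subsets (suc n)) (λ A → ∏ (λ i → w i (lookup A i)))
    ≡⟨ ∑-subsets n (λ A → ∏ (λ i → w i (lookup A i))) ⟩
  ∑ (subsets n) (λ A → w zero outside * tl A) + ∑ (subsets n) (λ A → w zero inside * tl A)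
    ≡⟨ cong₂ _+_ (*-∑ (w zero outside) (subsets n) tl) (*-∑ (w zero inside) (subsets n) tl) ⟩
  w zero outside * ∑ (subsets n) tl + w zero inside * ∑ (subsets n) tl
    ≡⟨ ℚ.*-distribʳ-+ (∑ (subsets n) tl) (w zero outside) (w zero inside) ⟨
  (w zero outside + w zero inside) * ∑ (subsets n) tl
    ≡⟨ cong (_*_ (w zero outside + w zero inside)) (∑-∏ n (w ∘ suc)) ⟩
  ∏ (λ i → w i outside + w i inside) ∎
  where
  tl : Subset n → ℚ
  tl A = ∏ (λ i → w (suc i) (lookup A i))

𝟙-all? : {P : Pred (Fin n) ℓ} (P? : Decidable P) → ∏ (λ i → 𝟙 (P? i)) ≡ 𝟙 (Fin.all? P?)
𝟙-all? {n = zero}  P? = refl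
𝟙-all? {n = suc n} P? = begin
  𝟙 (P? zero) * ∏ (λ i → 𝟙 (P? (suc i)))      ≡⟨ cong (_*_ (𝟙 (P? zero))) (𝟙-all? (P? ∘ suc)) ⟩
  𝟙 (P? zero) * 𝟙 (Fin.all? (P? ∘ suc))       ≡⟨ 𝟙-× (P? zero) (Fin.all? (P? ∘ suc)) ⟨
  𝟙 (P? zero ×-dec Fin.all? (P? ∘ suc))       ≡⟨ 𝟙-⇔ (λ { (p , ps) zero → p ; (p , ps) (suc i) → ps i })
                                                    (λ p → p zero , p ∘ suc)
                                                    (P? zero ×-dec Fin.all? (P? ∘ suc)) (Fin.all? P?) ⟩
  𝟙 (Fin.all? P?)                              ∎

-- Powers and cancellation

^-∸-* : ∀ x {m n} → n ℕ.≤ m → x ^ (m ∸ n) * x ^ n ≡ x ^ m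
^-∸-* x {m} {n} n≤m = trans (sym (^-homo-* x (m ∸ n) n)) (cong (x ^_) (ℕ.m∸n+n≡m n≤m))

^-pos : ∀ x .{{_ : Positive x}} n → Positive (x ^ n)
^-pos x zero    = _
^-pos x (suc n) = ℚ.pos*pos⇒pos x (x ^ n) {{^-pos x n}}

-- Turns a comparison of counts of colourings or eulerian sets into the inequalities for `k` and
-- `r`.
2^-cancel-≤ : ∀ a b → 2ℚ ^ a ≤ 2ℚ ^ b → a ℕ.≤ b
2^-cancel-≤ zero    b       _ = z≤n
2^-cancel-≤ (suc a) (suc b) p = s≤s (2^-cancel-≤ a b (ℚ.*-cancelˡ-≤-pos 2ℚ p))
2^-cancel-≤ (suc a) zero    p =
  contradiction (ℚ.≤-trans (ℚ.*-monoˡ-≤-nonNeg 2ℚ (1≤2^ a)) p) λ { (ℚ.*≤* (ℤ.+≤+ (s≤s ()))) }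
  where
  1≤2^ : ∀ a → 1ℚ ≤ 2ℚ ^ a
  1≤2^ zero    = ℚ.≤-refl
  1≤2^ (suc a) = ℚ.≤-trans (ℚ.*≤* (ℤ.+≤+ (s≤s z≤n))) (ℚ.*-monoˡ-≤-nonNeg 2ℚ (1≤2^ a))

*-cancelˡ-≡-pos : ∀ p .{{_ : Positive p}} {q r} → p * q ≡ p * r → q ≡ r
*-cancelˡ-≡-pos p eq = ℚ.≤-antisym (ℚ.*-cancelˡ-≤-pos p (ℚ.≤-reflexive eq))
                                   (ℚ.*-cancelˡ-≤-pos p (ℚ.≤-reflexive (sym eq)))

-- Size differences modulo 3 over pairs of subsets

-- For fixed `A` the map sending `B` to `A △ B` is an involution. An element of `A` exchanges the
-- two halves of the sum, whence the commutation in the second case.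
∑-△ : (A : Subset n) (Φ : Subset n → Subset n → ℚ) →
      ∑ (subsets n) (λ B → Φ (A △ B) B) ≡ ∑ (subsets n) (λ C → Φ C (A △ C))
∑-△ []                      Φ = refl
∑-△ {n = suc n} (outside ∷ A) Φ = begin
  ∑ (subsets (suc n)) (λ B → Φ ((outside ∷ A) △ B) B)
    ≡⟨ ∑-subsets n (λ B → Φ ((outside ∷ A) △ B) B) ⟩
  ∑ (subsets n) (λ B → Φ (outside ∷ (A △ B)) (outside ∷ B))
    + ∑ (subsets n) (λ B → Φ (inside ∷ (A △ B)) (inside ∷ B))
    ≡⟨ cong₂ _+_ (∑-△ A (λ C B → Φ (outside ∷ C) (outside ∷ B))) (∑-△ A (λ C B → Φ (inside ∷ C) (inside ∷ B))) ⟩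
  ∑ (subsets n) (λ C → Φ (outside ∷ C) (outside ∷ (A △ C)))
    + ∑ (subsets n) (λ C → Φ (inside ∷ C) (inside ∷ (A △ C)))
    ≡⟨ ∑-subsets n (λ C → Φ C ((outside ∷ A) △ C)) ⟨
  ∑ (subsets (suc n)) (λ C → Φ C ((outside ∷ A) △ C)) ∎
∑-△ {n = suc n} (inside ∷ A) Φ = begin
  ∑ (subsets (suc n)) (λ B → Φ ((inside ∷ A) △ B) B)
    ≡⟨ ∑-subsets n (λ B → Φ ((inside ∷ A) △ B) B) ⟩
  ∑ (subsets n) (λ B → Φ (inside ∷ (A △ B)) (outside ∷ B))
    + ∑ (subsets n) (λ B → Φ (outside ∷ (A △ B)) (inside ∷ B))
    ≡⟨ cong₂ _+_ (∑-△ A (λ C B → Φ (inside ∷ C) (outside ∷ B))) (∑-△ A (λ C B → Φ (outside ∷ C) (inside ∷ B))) ⟩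
  ∑ (subsets n) (λ C → Φ (inside ∷ C) (outside ∷ (A △ C)))
    + ∑ (subsets n) (λ C → Φ (outside ∷ C) (inside ∷ (A △ C)))
    ≡⟨ ℚ.+-comm (∑ (subsets n) (λ C → Φ (inside ∷ C) (outside ∷ (A △ C)))) _ ⟩
  ∑ (subsets n) (λ C → Φ (outside ∷ C) (inside ∷ (A △ C)))
    + ∑ (subsets n) (λ C → Φ (inside ∷ C) (outside ∷ (A △ C)))
    ≡⟨ ∑-subsets n (λ C → Φ C ((inside ∷ A) △ C)) ⟨
  ∑ (subsets (suc n)) (λ C → Φ C ((inside ∷ A) △ C)) ∎

-- If the sum of h vanishes over the residues of u - v mod 3, then h lies in the span of
-- the two characters ω^(u-v) and ω^(v-u).  Adding an edge to A △ B multiplies the sum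
-- over (A , B) by ω + ω⁻¹ = -1; adding it to neither or both of A and B gives a factor 2.
record Mod3Balanced (h : ℕ → ℕ → ℚ) : Set where
  field
    shift  : ∀ u v → h (suc u) (suc v) ≡ h u v
    cancel : ∀ u v → h (suc u) v + h u (suc v) ≡ - h u v

differenceWeight : Bool → ℚ
differenceWeight outside = 2ℚ
differenceWeight inside  = - 1ℚ

module _ {h : ℕ → ℕ → ℚ} (h-balanced : Mod3Balanced h) where
  open Mod3Balanced h-balanced

  -- Every edge peeled off leaves the same `h` with a scalar in front. The choice of `h` therefore
  -- survives only in its value at (0 , 0), so contrasts of different residues differ by a constant
  -- alone.
  ∑-fixed-difference : (C : Subset n) →
    ∑ (subsets n) (λ A → h ∣ A ∣ ∣ A △ C ∣) ≡ ∏ (λ e → differenceWeight (lookup C e)) * h 0 0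
  ∑-fixed-difference []                        = trans (ℚ.+-identityʳ (h 0 0)) (sym (ℚ.*-identityˡ (h 0 0)))
  ∑-fixed-difference {n = suc n} (outside ∷ C) = begin
    ∑ (subsets (suc n)) (λ A → h ∣ A ∣ ∣ A △ (outside ∷ C) ∣)
      ≡⟨ ∑-subsets n (λ A → h ∣ A ∣ ∣ A △ (outside ∷ C) ∣) ⟩
    S + ∑ (subsets n) (λ A → h (suc ∣ A ∣) (suc ∣ A △ C ∣))
      ≡⟨ cong (_+_ S) (∑-cong (subsets n) λ A → shift ∣ A ∣ ∣ A △ C ∣) ⟩
    S + S
      ≡⟨ cong₂ _+_ (∑-fixed-difference C) (∑-fixed-difference C) ⟩
    W * h 0 0 + W * h 0 0
      ≡⟨ solve 2 (λ w x → w :* x :+ w :* x := (con 2ℚ :* w) :* x) refl W (h 0 0) ⟩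
    2ℚ * W * h 0 0 ∎
    where
    S W : ℚ
    S = ∑ (subsets n) (λ A → h ∣ A ∣ ∣ A △ C ∣)
    W = ∏ (λ e → differenceWeight (lookup C e))
  ∑-fixed-difference {n = suc n} (inside ∷ C) = begin
    ∑ (subsets (suc n)) (λ A → h ∣ A ∣ ∣ A △ (inside ∷ C) ∣)
      ≡⟨ ∑-subsets n (λ A → h ∣ A ∣ ∣ A △ (inside ∷ C) ∣) ⟩
    ∑ (subsets n) up + ∑ (subsets n) left
      ≡⟨ ℚ.+-comm (∑ (subsets n) up) (∑ (subsets n) left) ⟩
    ∑ (subsets n) left + ∑ (subsets n) up
      ≡⟨ ∑-+ (subsets n) left up ⟨
    ∑ (subsets n) (λ A → left A + up A)
      ≡⟨ ∑-cong (subsets n) (λ A → trans (cancel ∣ A ∣ ∣ A △ C ∣)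
           (solve 1 (λ x → :- x := con (- 1ℚ) :* x) refl (h ∣ A ∣ ∣ A △ C ∣))) ⟩
    ∑ (subsets n) (λ A → - 1ℚ * h ∣ A ∣ ∣ A △ C ∣)
      ≡⟨ *-∑ (- 1ℚ) (subsets n) (λ A → h ∣ A ∣ ∣ A △ C ∣) ⟩
    - 1ℚ * ∑ (subsets n) (λ A → h ∣ A ∣ ∣ A △ C ∣)
      ≡⟨ cong (- 1ℚ *_) (∑-fixed-difference C) ⟩
    - 1ℚ * (W * h 0 0)
      ≡⟨ ℚ.*-assoc (- 1ℚ) W (h 0 0) ⟨
    - 1ℚ * W * h 0 0 ∎
    where
    W : ℚ
    W = ∏ (λ e → differenceWeight (lookup C e))
    up left : Subset n → ℚ
    up   A = h ∣ A ∣ (suc ∣ A △ C ∣)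
    left A = h (suc ∣ A ∣) ∣ A △ C ∣

  -- The weight `F` lets one computation serve both biases: the indicator of eulerian sets for the
  -- conditional one, the constant 1 for the unconditional one.
  ∑-outcomes-balanced : ∀ n (F : Subset n → ℚ) →
    ∑ (outcomes n) (λ (A , B) → F (A △ B) * h ∣ A ∣ ∣ B ∣)
      ≡ ∑ (subsets n) (λ C → F C * ∏ (λ e → differenceWeight (lookup C e))) * h 0 0
  ∑-outcomes-balanced n F = begin
    ∑ (outcomes n) (λ (A , B) → F (A △ B) * h ∣ A ∣ ∣ B ∣)
      ≡⟨ ∑-cartesianProduct (subsets n) (subsets n) (λ (A , B) → F (A △ B) * h ∣ A ∣ ∣ B ∣) ⟩
    ∑ (subsets n) (λ A → ∑ (subsets n) (λ B → F (A △ B) * h ∣ A ∣ ∣ B ∣))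
      ≡⟨ ∑-cong (subsets n) (λ A → ∑-△ A (λ C B → F C * h ∣ A ∣ ∣ B ∣)) ⟩
    ∑ (subsets n) (λ A → ∑ (subsets n) (λ C → F C * h ∣ A ∣ ∣ A △ C ∣))
      ≡⟨ ∑-comm (subsets n) (subsets n) (λ A C → F C * h ∣ A ∣ ∣ A △ C ∣) ⟩
    ∑ (subsets n) (λ C → ∑ (subsets n) (λ A → F C * h ∣ A ∣ ∣ A △ C ∣))
      ≡⟨ ∑-cong (subsets n) (λ C → trans (*-∑ (F C) (subsets n) (λ A → h ∣ A ∣ ∣ A △ C ∣))
                                         (cong (F C *_) (∑-fixed-difference C))) ⟩
    ∑ (subsets n) (λ C → F C * (W C * h 0 0))
      ≡⟨ ∑-cong (subsets n) (λ C → solve 3 (λ f w x → f :* (w :* x) := x :* (f :* w)) refl (F C) (W C) (h 0 0)) ⟩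
    ∑ (subsets n) (λ C → h 0 0 * (F C * W C))
      ≡⟨ *-∑ (h 0 0) (subsets n) (λ C → F C * W C) ⟩
    h 0 0 * ∑ (subsets n) (λ C → F C * W C)
      ≡⟨ ℚ.*-comm (h 0 0) _ ⟩
    ∑ (subsets n) (λ C → F C * W C) * h 0 0 ∎
    where
    W : Subset n → ℚ
    W C = ∏ (λ e → differenceWeight (lookup C e))

-- Each `C` arises once for every `A`; in other words `A △ B` is again uniform.
∑-outcomes-△ : ∀ n (F : Subset n → ℚ) →
  ∑ (outcomes n) (λ (A , B) → F (A △ B)) ≡ 2ℚ ^ n * ∑ (subsets n) F
∑-outcomes-△ n F = begin
  ∑ (outcomes n) (λ (A , B) → F (A △ B))
    ≡⟨ ∑-cartesianProduct (subsets n) (subsets n) (λ (A , B) → F (A △ B)) ⟩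
  ∑ (subsets n) (λ A → ∑ (subsets n) (λ B → F (A △ B)))
    ≡⟨ ∑-cong (subsets n) (λ A → ∑-△ A (λ C _ → F C)) ⟩
  ∑ (subsets n) (λ _ → ∑ (subsets n) F)
    ≡⟨ ∑-subsets-const n (∑ (subsets n) F) ⟩
  2ℚ ^ n * ∑ (subsets n) F ∎

congruent : ℕ → ℕ → ℚ
congruent u v = 𝟙 (u % 3 ℕ.≟ v % 3)

-- Removing three successors leaves `% 3` unchanged by computation, so the nine pairs of residues
-- suffice.
congruent-shift : ∀ u v → congruent (suc u) (suc v) ≡ congruent u v
congruent-shift 0 0 = refl
congruent-shift 0 1 = refl
congruent-shift 0 2 = refl
congruent-shift 1 0 = refl
congruent-shift 1 1 = refl
congruent-shift 1 2 = refl
congruent-shift 2 0 = refl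
congruent-shift 2 1 = refl
congruent-shift 2 2 = refl
congruent-shift u (suc (suc (suc v))) = congruent-shift u v
congruent-shift (suc (suc (suc u))) v = congruent-shift u v

-- `u - v` has exactly one of the residues -1, 1 and 0 modulo 3.
congruent-total : ∀ u v → congruent (suc u) v + congruent u (suc v) ≡ 1ℚ - congruent u v
congruent-total 0 0 = refl
congruent-total 0 1 = refl
congruent-total 0 2 = refl
congruent-total 1 0 = refl
congruent-total 1 1 = refl
congruent-total 1 2 = refl
congruent-total 2 0 = refl
congruent-total 2 1 = refl
congruent-total 2 2 = refl
congruent-total u (suc (suc (suc v))) = congruent-total u v
congruent-total (suc (suc (suc u))) v = congruent-total u v

-- A single congruence is not balanced, since its sum over the three residues is 1. Subtracting a
-- second one removes this constant.
contrast : ℕ → ℕ → ℕ → ℕ → ℚ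
contrast i j u v = congruent u (v ℕ.+ i) - congruent u (v ℕ.+ j)

contrast-balanced : ∀ i j → Mod3Balanced (contrast i j)
contrast-balanced i j = record
  { shift  = λ u v → cong₂ _-_ (congruent-shift u (v ℕ.+ i)) (congruent-shift u (v ℕ.+ j))
  ; cancel = λ u v → begin
      (congruent (suc u) (v ℕ.+ i) - congruent (suc u) (v ℕ.+ j)) +
      (congruent u (suc (v ℕ.+ i)) - congruent u (suc (v ℕ.+ j)))
        ≡⟨ solve 4 (λ a b c d → (a :- b) :+ (c :- d) := (a :+ c) :- (b :+ d)) refl
             (congruent (suc u) (v ℕ.+ i)) (congruent (suc u) (v ℕ.+ j))
             (congruent u (suc (v ℕ.+ i))) (congruent u (suc (v ℕ.+ j))) ⟩
      (congruent (suc u) (v ℕ.+ i) + congruent u (suc (v ℕ.+ i))) -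
      (congruent (suc u) (v ℕ.+ j) + congruent u (suc (v ℕ.+ j)))
        ≡⟨ cong₂ _-_ (congruent-total u (v ℕ.+ i)) (congruent-total u (v ℕ.+ j)) ⟩
      (1ℚ - congruent u (v ℕ.+ i)) - (1ℚ - congruent u (v ℕ.+ j))
        ≡⟨ solve 2 (λ a b → (con 1ℚ :- a) :- (con 1ℚ :- b) := :- (a :- b)) refl
             (congruent u (v ℕ.+ i)) (congruent u (v ℕ.+ j)) ⟩
      - contrast i j u v ∎
  }

-- Probabilities as normalised sums

suc/1 : ∀ a → + suc a / 1 ≡ 1ℚ + + a / 1
suc/1 a = ℚ.toℚᵘ-injective (begin-ℚᵘ
  ℚ.toℚᵘ (ℚ.fromℚᵘ (mkℚᵘ (+ suc a) 0))
    ≈⟨ ℚ.toℚᵘ-fromℚᵘ (mkℚᵘ (+ suc a) 0) ⟩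
  mkℚᵘ (+ suc a) 0
    ≈⟨ ℚᵘ.*≡* (cong (ℤ._* + 1) (cong (ℤ._+_ (+ 1)) (sym (ℤ.*-identityʳ (+ a))))) ⟩
  mkℚᵘ (+ 1) 0 ℚᵘ.+ mkℚᵘ (+ a) 0
    ≈⟨ ℚᵘ.+-congʳ (mkℚᵘ (+ 1) 0) (ℚ.toℚᵘ-fromℚᵘ (mkℚᵘ (+ a) 0)) ⟨
  ℚ.toℚᵘ 1ℚ ℚᵘ.+ ℚ.toℚᵘ (ℚ.fromℚᵘ (mkℚᵘ (+ a) 0))
    ≈⟨ ℚ.toℚᵘ-homo-+ 1ℚ (+ a / 1) ⟨
  ℚ.toℚᵘ (1ℚ + + a / 1) ∎ℚᵘ)
  where open ℚᵘ.≃-Reasoning renaming (begin_ to begin-ℚᵘ_; _∎ to _∎ℚᵘ)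

-- Normalisation by the gcd does not compute on variables, so the identity is checked by
-- cross-multiplying unnormalised fractions.
/-split : ∀ a d .{{_ : ℕ.NonZero d}} → + a / d ≡ + a / 1 * (+ 1 / d)
/-split a (suc d) = ℚ.toℚᵘ-injective (begin-ℚᵘ
  ℚ.toℚᵘ (ℚ.fromℚᵘ (mkℚᵘ (+ a) d))
    ≈⟨ ℚ.toℚᵘ-fromℚᵘ (mkℚᵘ (+ a) d) ⟩
  mkℚᵘ (+ a) d
    ≈⟨ ℚᵘ.*≡* (cong₂ ℤ._*_ (sym (ℤ.*-identityʳ (+ a))) (cong +_ (ℕ.*-identityˡ (suc d)))) ⟩
  mkℚᵘ (+ a) 0 ℚᵘ.* mkℚᵘ (+ 1) d
    ≈⟨ ℚᵘ.*-cong (ℚ.toℚᵘ-fromℚᵘ (mkℚᵘ (+ a) 0)) (ℚ.toℚᵘ-fromℚᵘ (mkℚᵘ (+ 1) d)) ⟨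
  ℚ.toℚᵘ (ℚ.fromℚᵘ (mkℚᵘ (+ a) 0)) ℚᵘ.* ℚ.toℚᵘ (ℚ.fromℚᵘ (mkℚᵘ (+ 1) d))
    ≈⟨ ℚ.toℚᵘ-homo-* (+ a / 1) (+ 1 / suc d) ⟨
  ℚ.toℚᵘ (+ a / 1 * (+ 1 / suc d)) ∎ℚᵘ)
  where open ℚᵘ.≃-Reasoning renaming (begin_ to begin-ℚᵘ_; _∎ to _∎ℚᵘ)

n/n≡1 : ∀ n .{{_ : ℕ.NonZero n}} → + n / n ≡ 1ℚ
n/n≡1 (suc n) = ℚ.fromℚᵘ-cong {mkℚᵘ (+ suc n) n} {mkℚᵘ (+ 1) 0}
  (ℚᵘ.*≡* (ℤ.*-comm (+ suc n) (+ 1)))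

∑-1≡length : (xs : List X) → ∑ xs (λ _ → 1ℚ) ≡ + length xs / 1
∑-1≡length []       = refl
∑-1≡length (x ∷ xs) = trans (cong (_+_ 1ℚ) (∑-1≡length xs)) (sym (suc/1 (length xs)))

∑-𝟙≡length-filter : {P : Pred X ℓ} (P? : Decidable P) (xs : List X) →
                     ∑ xs (λ x → 𝟙 (P? x)) ≡ + length (filter P? xs) / 1
∑-𝟙≡length-filter P? []       = refl
∑-𝟙≡length-filter P? (x ∷ xs) with does (P? x)
... | true  = trans (cong (_+_ 1ℚ) (∑-𝟙≡length-filter P? xs)) (sym (suc/1 (length (filter P? xs))))
... | false = trans (ℚ.+-identityˡ _) (∑-𝟙≡length-filter P? xs)

pointMass : ℕ → ℚ
pointMass n = (+ 1 / length (outcomes n)) {{∣outcomes∣≢0 n}}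

pointMass-total : ∀ n → 2ℚ ^ n * 2ℚ ^ n * pointMass n ≡ 1ℚ
pointMass-total n = begin
  2ℚ ^ n * 2ℚ ^ n * pointMass n
    ≡⟨ cong (λ t → 2ℚ ^ n * t * pointMass n) (trans (∑-subsets-const n 1ℚ) (ℚ.*-identityʳ (2ℚ ^ n))) ⟨
  2ℚ ^ n * ∑ (subsets n) (λ _ → 1ℚ) * pointMass n
    ≡⟨ cong (_* pointMass n) (∑-outcomes-△ n (λ _ → 1ℚ)) ⟨
  ∑ (outcomes n) (λ _ → 1ℚ) * pointMass n
    ≡⟨ cong (_* pointMass n) (∑-1≡length (outcomes n)) ⟩
  + length (outcomes n) / 1 * pointMass n
    ≡⟨ /-split (length (outcomes n)) (length (outcomes n)) {{∣outcomes∣≢0 n}} ⟨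
  (+ length (outcomes n) / length (outcomes n)) {{∣outcomes∣≢0 n}}
    ≡⟨ n/n≡1 (length (outcomes n)) {{∣outcomes∣≢0 n}} ⟩
  1ℚ ∎

ℙ-∑ : {P : Pred (Ω n) 0ℓ} (P? : Decidable P) →
      ℙ P? ≡ pointMass n * ∑ (outcomes n) (λ ω → 𝟙 (P? ω))
ℙ-∑ {n} P? = begin
  ℙ P?
    ≡⟨ /-split (length (filter P? (outcomes n))) (length (outcomes n)) {{∣outcomes∣≢0 n}} ⟩
  + length (filter P? (outcomes n)) / 1 * pointMass n
    ≡⟨ ℚ.*-comm (+ length (filter P? (outcomes n)) / 1) (pointMass n) ⟩
  pointMass n * (+ length (filter P? (outcomes n)) / 1)
    ≡⟨ cong (pointMass n *_) (∑-𝟙≡length-filter P? (outcomes n)) ⟨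
  pointMass n * ∑ (outcomes n) (λ ω → 𝟙 (P? ω)) ∎

Bias-∑ : {P : Pred (Ω n) 0ℓ} (P? : Decidable P) →
         Bias P? ≡ pointMass n * ∑ (outcomes n) (λ ω → 2ℚ * 𝟙 (P? ω) - 1ℚ)
Bias-∑ {n} P? = begin
  ℙ P? - ℙ (∁? P?)
    ≡⟨ cong₂ _-_ (ℙ-∑ P?) (ℙ-∑ (∁? P?)) ⟩
  pointMass n * p - pointMass n * q
    ≡⟨ solve 3 (λ p q c → c :* p :- c :* q := c :* (p :- q)) refl p q (pointMass n) ⟩
  pointMass n * (p - q)
    ≡⟨ cong (pointMass n *_) (∑-- (outcomes n) (λ ω → 𝟙 (P? ω)) (λ ω → 𝟙 (∁? P? ω))) ⟨
  pointMass n * ∑ (outcomes n) (λ ω → 𝟙 (P? ω) - 𝟙 (∁? P? ω))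
    ≡⟨ cong (pointMass n *_) (∑-cong (outcomes n) λ ω → trans (cong (_-_ (𝟙 (P? ω))) (𝟙-¬ (P? ω)))
         (solve 1 (λ x → x :- (con 1ℚ :- x) := con 2ℚ :* x :- con 1ℚ) refl (𝟙 (P? ω)))) ⟩
  pointMass n * ∑ (outcomes n) (λ ω → 2ℚ * 𝟙 (P? ω) - 1ℚ) ∎
  where
  p q : ℚ
  p = ∑ (outcomes n) (λ ω → 𝟙 (P? ω))
  q = ∑ (outcomes n) (λ ω → 𝟙 (∁? P? ω))

Bias-difference : {P P′ : Pred (Ω n) 0ℓ} (P? : Decidable P) (P′? : Decidable P′) →
  Bias P? - Bias P′? ≡ 2ℚ * pointMass n * ∑ (outcomes n) (λ ω → 𝟙 (P? ω) - 𝟙 (P′? ω))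
Bias-difference {n} P? P′? = begin
  Bias P? - Bias P′?
    ≡⟨ cong₂ _-_ (Bias-∑ P?) (Bias-∑ P′?) ⟩
  c * ∑ (outcomes n) p - c * ∑ (outcomes n) p′
    ≡⟨ solve 3 (λ p q c → c :* p :- c :* q := c :* (p :- q)) refl (∑ (outcomes n) p) (∑ (outcomes n) p′) c ⟩
  c * (∑ (outcomes n) p - ∑ (outcomes n) p′)
    ≡⟨ cong (c *_) (∑-- (outcomes n) p p′) ⟨
  c * ∑ (outcomes n) (λ ω → p ω - p′ ω)
    ≡⟨ cong (c *_) (∑-cong (outcomes n) λ ω →
         solve 2 (λ x y → (con 2ℚ :* x :- con 1ℚ) :- (con 2ℚ :* y :- con 1ℚ) := con 2ℚ :* (x :- y)) refl
           (𝟙 (P? ω)) (𝟙 (P′? ω))) ⟩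
  c * ∑ (outcomes n) (λ ω → 2ℚ * (𝟙 (P? ω) - 𝟙 (P′? ω)))
    ≡⟨ cong (c *_) (*-∑ 2ℚ (outcomes n) (λ ω → 𝟙 (P? ω) - 𝟙 (P′? ω))) ⟩
  c * (2ℚ * ∑ (outcomes n) (λ ω → 𝟙 (P? ω) - 𝟙 (P′? ω)))
    ≡⟨ solve 2 (λ c s → c :* (con 2ℚ :* s) := (con 2ℚ :* c) :* s) refl
         c (∑ (outcomes n) (λ ω → 𝟙 (P? ω) - 𝟙 (P′? ω))) ⟩
  2ℚ * c * ∑ (outcomes n) (λ ω → 𝟙 (P? ω) - 𝟙 (P′? ω)) ∎
  where
  c : ℚ
  c = pointMass n
  p p′ : Ω n → ℚ
  p  ω = 2ℚ * 𝟙 (P? ω) - 1ℚ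
  p′ ω = 2ℚ * 𝟙 (P′? ω) - 1ℚ

module _ {Q : Pred (Ω n) 0ℓ} (Q? : Decidable Q) .{{_ : NonZero (ℙ Q?)}} where

  Bias∣-∑ : {P : Pred (Ω n) 0ℓ} (P? : Decidable P) →
    Bias[ P? ∣ Q? ] ≡ 1/ ℙ Q? * pointMass n * ∑ (outcomes n) (λ ω → 𝟙 (Q? ω) * (2ℚ * 𝟙 (P? ω) - 1ℚ))
  Bias∣-∑ P? = begin
    ℙ (P? ∩? Q?) * 1/ ℙ Q? - ℙ (∁? P? ∩? Q?) * 1/ ℙ Q?
      ≡⟨ cong₂ (λ a b → a * 1/ ℙ Q? - b * 1/ ℙ Q?) (ℙ-∑ (P? ∩? Q?)) (ℙ-∑ (∁? P? ∩? Q?)) ⟩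
    pointMass n * p * 1/ ℙ Q? - pointMass n * q * 1/ ℙ Q?
      ≡⟨ solve 4 (λ p q c k → c :* p :* k :- c :* q :* k := k :* c :* (p :- q)) refl
           p q (pointMass n) (1/ ℙ Q?) ⟩
    1/ ℙ Q? * pointMass n * (p - q)
      ≡⟨ cong (_*_ (1/ ℙ Q? * pointMass n)) (∑-- (outcomes n)
           (λ ω → 𝟙 ((P? ∩? Q?) ω)) (λ ω → 𝟙 ((∁? P? ∩? Q?) ω))) ⟨
    1/ ℙ Q? * pointMass n * ∑ (outcomes n) (λ ω → 𝟙 ((P? ∩? Q?) ω) - 𝟙 ((∁? P? ∩? Q?) ω))
      ≡⟨ cong (_*_ (1/ ℙ Q? * pointMass n)) (∑-cong (outcomes n) λ ω → begin
           𝟙 ((P? ∩? Q?) ω) - 𝟙 ((∁? P? ∩? Q?) ω)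
             ≡⟨ cong₂ _-_ (𝟙-× (P? ω) (Q? ω))
                  (trans (𝟙-× (¬? (P? ω)) (Q? ω)) (cong (_* 𝟙 (Q? ω)) (𝟙-¬ (P? ω)))) ⟩
           𝟙 (P? ω) * 𝟙 (Q? ω) - (1ℚ - 𝟙 (P? ω)) * 𝟙 (Q? ω)
             ≡⟨ solve 2 (λ x y → x :* y :- (con 1ℚ :- x) :* y := y :* (con 2ℚ :* x :- con 1ℚ)) refl
                  (𝟙 (P? ω)) (𝟙 (Q? ω)) ⟩
           𝟙 (Q? ω) * (2ℚ * 𝟙 (P? ω) - 1ℚ) ∎) ⟩
    1/ ℙ Q? * pointMass n * ∑ (outcomes n) (λ ω → 𝟙 (Q? ω) * (2ℚ * 𝟙 (P? ω) - 1ℚ)) ∎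
    where
    p q : ℚ
    p = ∑ (outcomes n) (λ ω → 𝟙 ((P? ∩? Q?) ω))
    q = ∑ (outcomes n) (λ ω → 𝟙 ((∁? P? ∩? Q?) ω))

  -- The factor `2ℚ * pointMass n` is kept in front exactly as in `Bias-difference`, so that it
  -- cancels in the quotient of the two contrasts.
  Bias∣-difference : {P P′ : Pred (Ω n) 0ℓ} (P? : Decidable P) (P′? : Decidable P′) →
    Bias[ P? ∣ Q? ] - Bias[ P′? ∣ Q? ]
      ≡ 2ℚ * pointMass n * (1/ ℙ Q? * ∑ (outcomes n) (λ ω → 𝟙 (Q? ω) * (𝟙 (P? ω) - 𝟙 (P′? ω))))
  Bias∣-difference P? P′? = begin
    Bias[ P? ∣ Q? ] - Bias[ P′? ∣ Q? ]
      ≡⟨ cong₂ _-_ (Bias∣-∑ P?) (Bias∣-∑ P′?) ⟩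
    c * ∑ (outcomes n) p - c * ∑ (outcomes n) p′
      ≡⟨ solve 3 (λ p q c → c :* p :- c :* q := c :* (p :- q)) refl (∑ (outcomes n) p) (∑ (outcomes n) p′) c ⟩
    c * (∑ (outcomes n) p - ∑ (outcomes n) p′)
      ≡⟨ cong (c *_) (∑-- (outcomes n) p p′) ⟨
    c * ∑ (outcomes n) (λ ω → p ω - p′ ω)
      ≡⟨ cong (c *_) (∑-cong (outcomes n) λ ω →
           solve 3 (λ x y q → q :* (con 2ℚ :* x :- con 1ℚ) :- q :* (con 2ℚ :* y :- con 1ℚ)
                          := con 2ℚ :* (q :* (x :- y))) refl
             (𝟙 (P? ω)) (𝟙 (P′? ω)) (𝟙 (Q? ω))) ⟩
    c * ∑ (outcomes n) (λ ω → 2ℚ * d ω)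
      ≡⟨ cong (c *_) (*-∑ 2ℚ (outcomes n) d) ⟩
    1/ ℙ Q? * pointMass n * (2ℚ * ∑ (outcomes n) d)
      ≡⟨ solve 3 (λ k c s → k :* c :* (con 2ℚ :* s) := con 2ℚ :* c :* (k :* s)) refl
           (1/ ℙ Q?) (pointMass n) (∑ (outcomes n) d) ⟩
    2ℚ * pointMass n * (1/ ℙ Q? * ∑ (outcomes n) d) ∎
    where
    c : ℚ
    c = 1/ ℙ Q? * pointMass n
    p p′ d : Ω n → ℚ
    p  ω = 𝟙 (Q? ω) * (2ℚ * 𝟙 (P? ω) - 1ℚ)
    p′ ω = 𝟙 (Q? ω) * (2ℚ * 𝟙 (P′? ω) - 1ℚ)
    d  ω = 𝟙 (Q? ω) * (𝟙 (P? ω) - 𝟙 (P′? ω))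

-- Eulerian subgraphs and two-colourings

spin : Bool → ℚ
spin false = 1ℚ
spin true  = - 1ℚ

spin-* : ∀ a b → 1ℚ + spin a * spin b ≡ 2ℚ * 𝟙 (a Bool.≟ b)
spin-* false false = refl
spin-* false true  = refl
spin-* true  false = refl
spin-* true  true  = refl

spin-^ : ∀ d → spin false ^ d + spin true ^ d ≡ 2ℚ * 𝟙 (2 ∣? d)
spin-^ 0             = refl
spin-^ 1             = refl
spin-^ (suc (suc d)) = begin
  1ℚ * (1ℚ * 1ℚ ^ d) + - 1ℚ * (- 1ℚ * (- 1ℚ) ^ d)
    ≡⟨ solve 2 (λ x y → con 1ℚ :* (con 1ℚ :* x) :+ con (- 1ℚ) :* (con (- 1ℚ) :* y) := x :+ y) refl
         (1ℚ ^ d) ((- 1ℚ) ^ d) ⟩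
  1ℚ ^ d + (- 1ℚ) ^ d
    -- `does (2 ∣? suc (suc d))` computes to `does (2 ∣? d)`, so this already is the required
    -- right-hand side.
    ≡⟨ spin-^ d ⟩
  2ℚ * 𝟙 (2 ∣? d) ∎

^-sum : ∀ x (g : Fin n → ℕ) → x ^ sum (List.tabulate g) ≡ ∏ (λ i → x ^ g i)
^-sum {zero}  x g = refl
^-sum {suc n} x g = trans (^-homo-* x (g zero) (sum (List.tabulate (g ∘ suc))))
  (cong (x ^ g zero *_) (^-sum x (g ∘ suc)))

∏-select : (s : Fin n → ℚ) (a : Fin n) → ∏ (λ w → s w ^ (if does (a Fin.≟ w) then 1 else 0)) ≡ s a
∏-select {suc n} s zero    = trans (cong₂ _*_ (ℚ.*-identityʳ (s zero)) (∏-1 n)) (ℚ.*-identityʳ (s zero))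
∏-select {suc n} s (suc a) = trans (ℚ.*-identityˡ _) (∏-select (s ∘ suc) a)

module _ (G : Graph) where
  open Graph G

  private
    p q : Edge → Vertex
    p e = proj₁ (ends e)
    q e = proj₂ (ends e)

  -- Double counting of incidences: exchanging the products collects, for each edge of `C`, one
  -- factor per end. A loop gives the square of `s` at its vertex, in accordance with its degree 2.
  ∏-^-degree : (s : Vertex → ℚ) (C : EdgeSet) →
    ∏ (λ w → s w ^ degree G C w) ≡ ∏ (λ e → if lookup C e then s (p e) * s (q e) else 1ℚ)
  ∏-^-degree s C = begin
    ∏ (λ w → s w ^ degree G C w)
      ≡⟨ ∏-cong (λ w → trans (cong (λ l → s w ^ sum l) (map-tabulate (λ e → e) (λ e → deg e w)))
                             (^-sum (s w) (λ e → deg e w))) ⟩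
    ∏ (λ w → ∏ (λ e → s w ^ deg e w))
      ≡⟨ Prod.∑-comm (λ w e → s w ^ deg e w) ⟩
    ∏ (λ e → ∏ (λ w → s w ^ deg e w))
      ≡⟨ ∏-cong edge ⟩
    ∏ (λ e → if lookup C e then s (p e) * s (q e) else 1ℚ) ∎
    where
    deg : Edge → Vertex → ℕ
    deg e w = if lookup C e then endCount G e w else 0

    hits : Vertex → Vertex → ℕ
    hits a w = if does (a Fin.≟ w) then 1 else 0

    edge : ∀ e → ∏ (λ w → s w ^ deg e w) ≡ (if lookup C e then s (p e) * s (q e) else 1ℚ)
    edge e with lookup C e
    ... | false = ∏-1 order
    ... | true  = begin
      ∏ (λ w → s w ^ (hits (p e) w ℕ.+ hits (q e) w))
        ≡⟨ ∏-cong (λ w → ^-homo-* (s w) (hits (p e) w) (hits (q e) w)) ⟩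
      ∏ (λ w → s w ^ hits (p e) w * s w ^ hits (q e) w)
        ≡⟨ ∏-* (λ w → s w ^ hits (p e) w) (λ w → s w ^ hits (q e) w) ⟩
      ∏ (λ w → s w ^ hits (p e) w) * ∏ (λ w → s w ^ hits (q e) w)
        ≡⟨ cong₂ _*_ (∏-select s (p e)) (∏-select s (q e)) ⟩
      s (p e) * s (q e) ∎

  -- At each vertex 1 + (-1)^deg is 2 or 0 according to parity; expanding the product of these
  -- binomials gives the sum over colourings.
  𝟙-eulerian : (C : EdgeSet) →
    2ℚ ^ order * 𝟙 (eulerian? G C) ≡ ∑ (subsets order) (λ σ → ∏ (λ w → spin (lookup σ w) ^ degree G C w))
  𝟙-eulerian C = begin
    2ℚ ^ order * 𝟙 (eulerian? G C)
      ≡⟨ cong₂ _*_ (∏-const order 2ℚ) (𝟙-all? (λ w → 2 ∣? degree G C w)) ⟨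
    ∏ {order} (λ _ → 2ℚ) * ∏ (λ w → 𝟙 (2 ∣? degree G C w))
      ≡⟨ ∏-* (λ _ → 2ℚ) (λ w → 𝟙 (2 ∣? degree G C w)) ⟨
    ∏ (λ w → 2ℚ * 𝟙 (2 ∣? degree G C w))
      ≡⟨ ∏-cong (λ w → spin-^ (degree G C w)) ⟨
    ∏ (λ w → spin false ^ degree G C w + spin true ^ degree G C w)
      ≡⟨ ∑-∏ order (λ w b → spin b ^ degree G C w) ⟨
    ∑ (subsets order) (λ σ → ∏ (λ w → spin (lookup σ w) ^ degree G C w)) ∎

  -- The weights may depend on the edge because there are two uses: `differenceWeight` for the
  -- biases, and the indicator of being contained in a given `A` for the counts behind the rank
  -- inequalities.
  ∑-eulerian : (f : Edge → Bool → ℚ) →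
    2ℚ ^ order * ∑ (subsets size) (λ C → 𝟙 (eulerian? G C) * ∏ (λ e → f e (lookup C e)))
      ≡ ∑ (subsets order) (λ σ → ∏ (λ e →
          f e outside + f e inside * (spin (lookup σ (p e)) * spin (lookup σ (q e)))))
  ∑-eulerian f = begin
    2ℚ ^ order * ∑ (subsets size) (λ C → 𝟙 (eulerian? G C) * ∏ (λ e → f e (lookup C e)))
      ≡⟨ *-∑ (2ℚ ^ order) (subsets size) (λ C → 𝟙 (eulerian? G C) * ∏ (λ e → f e (lookup C e))) ⟨
    ∑ (subsets size) (λ C → 2ℚ ^ order * (𝟙 (eulerian? G C) * ∏ (λ e → f e (lookup C e))))
      ≡⟨ ∑-cong (subsets size) expand ⟩
    ∑ (subsets size) (λ C → ∑ (subsets order) (λ σ → ∏ (λ e → w σ e (lookup C e))))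
      ≡⟨ ∑-comm (subsets size) (subsets order) (λ C σ → ∏ (λ e → w σ e (lookup C e))) ⟩
    ∑ (subsets order) (λ σ → ∑ (subsets size) (λ C → ∏ (λ e → w σ e (lookup C e))))
      ≡⟨ ∑-cong (subsets order) (λ σ → ∑-∏ size (w σ)) ⟩
    ∑ (subsets order) (λ σ → ∏ (λ e → f e outside * 1ℚ + f e inside * ss σ e))
      ≡⟨ ∑-cong (subsets order) (λ σ → ∏-cong λ e →
           cong (_+ f e inside * ss σ e) (ℚ.*-identityʳ (f e outside))) ⟩
    ∑ (subsets order) (λ σ → ∏ (λ e → f e outside + f e inside * ss σ e)) ∎
    where
    ss : Subset order → Edge → ℚ
    ss σ e = spin (lookup σ (p e)) * spin (lookup σ (q e))

    w : Subset order → Edge → Bool → ℚ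
    w σ e b = f e b * (if b then ss σ e else 1ℚ)

    expand : ∀ C → 2ℚ ^ order * (𝟙 (eulerian? G C) * ∏ (λ e → f e (lookup C e)))
                   ≡ ∑ (subsets order) (λ σ → ∏ (λ e → w σ e (lookup C e)))
    expand C = begin
      2ℚ ^ order * (𝟙 (eulerian? G C) * F)
        ≡⟨ solve 3 (λ t x f → t :* (x :* f) := f :* (t :* x)) refl (2ℚ ^ order) (𝟙 (eulerian? G C)) F ⟩
      F * (2ℚ ^ order * 𝟙 (eulerian? G C))
        ≡⟨ cong (F *_) (𝟙-eulerian C) ⟩
      F * ∑ (subsets order) (λ σ → ∏ (λ w → spin (lookup σ w) ^ degree G C w))
        ≡⟨ *-∑ F (subsets order) (λ σ → ∏ (λ w → spin (lookup σ w) ^ degree G C w)) ⟨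
      ∑ (subsets order) (λ σ → F * ∏ (λ w → spin (lookup σ w) ^ degree G C w))
        ≡⟨ ∑-cong (subsets order) (λ σ → trans
             (cong (F *_) (∏-^-degree (λ w → spin (lookup σ w)) C))
             (sym (∏-* (λ e → f e (lookup C e)) (λ e → if lookup C e then ss σ e else 1ℚ)))) ⟩
      ∑ (subsets order) (λ σ → ∏ (λ e → w σ e (lookup C e))) ∎
      where
      F : ℚ
      F = ∏ (λ e → f e (lookup C e))

-- Counting the two-colourings that are constant on components

ConstantOnFibres : (Fin n → X) → Subset n → Set
ConstantOnFibres f σ = ∀ u w → f u ≡ f w → lookup σ u ≡ lookup σ w

module _ {X : Set} (_≟_ : DecidableEquality X) where

  private
    remove : X → List X → List X
    remove x = filter (¬? ∘ (x ≟_))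

  length-remove-∈ : ∀ {x xs} → Unique xs → x ∈ₗ xs → suc (length (remove x xs)) ≡ length xs
  length-remove-∈ {x} {y ∷ xs} (y∉xs ∷ xs!) x∈ with x ≟ y
  ... | yes refl = cong (suc ∘ length) (filter-all (¬? ∘ (x ≟_)) y∉xs)
  ... | no x≢y   = cong suc (length-remove-∈ xs!
    (case x∈ of λ { (here x≡y) → contradiction x≡y x≢y ; (there x∈xs) → x∈xs }))

  -- `deduplicate` puts `x` in front and strikes it out of the deduplicated tail, where it occurs
  -- exactly once; the two changes of length cancel.
  length-deduplicate-∈ : ∀ {x xs} → x ∈ₗ xs →
    length (deduplicate _≟_ (x ∷ xs)) ≡ length (deduplicate _≟_ xs)
  length-deduplicate-∈ {x} {xs} x∈xs = length-remove-∈ (deduplicate-! _≟_ xs) (∈-deduplicate⁺ _≟_ x∈xs)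

  length-deduplicate-∉ : ∀ {x xs} → ¬ x ∈ₗ xs →
    length (deduplicate _≟_ (x ∷ xs)) ≡ suc (length (deduplicate _≟_ xs))
  length-deduplicate-∉ {x} {xs} x∉xs = cong (suc ∘ length) (filter-all (¬? ∘ (x ≟_))
    (All.tabulate λ y∈ x≡y → x∉xs (subst (_∈ₗ xs) (sym x≡y) (∈-deduplicate⁻ _≟_ xs y∈))))

  constantOnFibres? : (f : Fin n → X) → Decidable (ConstantOnFibres f)
  constantOnFibres? f σ = Fin.all? λ u → Fin.all? λ w → (f u ≟ f w) →-dec (lookup σ u Bool.≟ lookup σ w)

  private
    tail-constant : (f : Fin (suc n) → X) {b : Bool} {σ : Subset n} →
                    ConstantOnFibres f (b ∷ σ) → ConstantOnFibres (f ∘ suc) σ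
    tail-constant f c u w = c (suc u) (suc w)

    -- Any colour b of the vertex zero is admissible that agrees with the rest of its fibre.
    extend : (f : Fin (suc n) → X) {b : Bool} {σ : Subset n} →
             (∀ w → f zero ≡ f (suc w) → b ≡ lookup σ w) →
             ConstantOnFibres (f ∘ suc) σ → ConstantOnFibres f (b ∷ σ)
    extend f h c zero    zero    _  = refl
    extend f h c zero    (suc w) eq = h w eq
    extend f h c (suc u) zero    eq = sym (h u (sym eq))
    extend f h c (suc u) (suc w) eq = c u w eq

  -- Induction on the vertices. If the value at `zero` recurs at a later vertex `v`, the colour of
  -- `zero` is forced by that of `v`; otherwise it is free and the count doubles, just as the list
  -- of distinct values grows by one.
  ∑-constantOnFibres : (f : Fin n → X) →
    ∑ (subsets n) (λ σ → 𝟙 (constantOnFibres? f σ)) ≡ 2ℚ ^ length (deduplicate _≟_ (List.tabulate f))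
  ∑-constantOnFibres {zero}  f = refl
  ∑-constantOnFibres {suc n} f with Fin.any? (λ w → f zero ≟ f (suc w))
  ... | yes (v , f0≡fv) = begin
    ∑ (subsets (suc n)) (λ σ → 𝟙 (constantOnFibres? f σ))
      ≡⟨ ∑-subsets n (λ σ → 𝟙 (constantOnFibres? f σ)) ⟩
    ∑ (subsets n) (λ σ → 𝟙 (constantOnFibres? f (false ∷ σ)))
      + ∑ (subsets n) (λ σ → 𝟙 (constantOnFibres? f (true ∷ σ)))
      ≡⟨ ∑-+ (subsets n) (λ σ → 𝟙 (constantOnFibres? f (false ∷ σ)))
                            (λ σ → 𝟙 (constantOnFibres? f (true ∷ σ))) ⟨
    ∑ (subsets n) (λ σ → 𝟙 (constantOnFibres? f (false ∷ σ)) + 𝟙 (constantOnFibres? f (true ∷ σ)))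
      ≡⟨ ∑-cong (subsets n) step ⟩
    ∑ (subsets n) (λ σ → 𝟙 (constantOnFibres? (f ∘ suc) σ))
      ≡⟨ ∑-constantOnFibres (f ∘ suc) ⟩
    2ℚ ^ length (deduplicate _≟_ (List.tabulate (f ∘ suc)))
      ≡⟨ cong (2ℚ ^_) (length-deduplicate-∈
           (subst (_∈ₗ List.tabulate (f ∘ suc)) (sym f0≡fv) (∈-tabulate⁺ {f = f ∘ suc} v))) ⟨
    2ℚ ^ length (deduplicate _≟_ (List.tabulate f)) ∎
    where
    forced : ∀ b σ → b ≡ lookup σ v → 𝟙 (constantOnFibres? f (b ∷ σ)) ≡ 𝟙 (constantOnFibres? (f ∘ suc) σ)
    forced b σ b≡ = 𝟙-⇔ (tail-constant f)
      (λ c → extend f (λ w f0≡fw → trans b≡ (c v w (trans (sym f0≡fv) f0≡fw))) c)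
      (constantOnFibres? f (b ∷ σ)) (constantOnFibres? (f ∘ suc) σ)

    excluded : ∀ b σ → b ≢ lookup σ v → 𝟙 (constantOnFibres? f (b ∷ σ)) ≡ 0ℚ
    excluded b σ b≢ = 𝟙-⇔ (λ c → b≢ (c zero (suc v) f0≡fv)) (λ ()) (constantOnFibres? f (b ∷ σ)) (no λ ())

    step : ∀ σ → 𝟙 (constantOnFibres? f (false ∷ σ)) + 𝟙 (constantOnFibres? f (true ∷ σ))
                 ≡ 𝟙 (constantOnFibres? (f ∘ suc) σ)
    step σ with lookup σ v in eq
    ... | false = trans (cong₂ _+_ (forced false σ (sym eq)) (excluded true σ λ t → case trans t eq of λ ()))
                        (ℚ.+-identityʳ _)
    ... | true  = trans (cong₂ _+_ (excluded false σ λ t → case trans t eq of λ ()) (forced true σ (sym eq)))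
                        (ℚ.+-identityˡ _)
  ... | no f0∉ = begin
    ∑ (subsets (suc n)) (λ σ → 𝟙 (constantOnFibres? f σ))
      ≡⟨ ∑-subsets n (λ σ → 𝟙 (constantOnFibres? f σ)) ⟩
    ∑ (subsets n) (λ σ → 𝟙 (constantOnFibres? f (false ∷ σ)))
      + ∑ (subsets n) (λ σ → 𝟙 (constantOnFibres? f (true ∷ σ)))
      ≡⟨ cong₂ _+_ (∑-cong (subsets n) (free false)) (∑-cong (subsets n) (free true)) ⟩
    N + N
      ≡⟨ solve 1 (λ x → x :+ x := con 2ℚ :* x) refl N ⟩
    2ℚ * N
      ≡⟨ cong (2ℚ *_) (∑-constantOnFibres (f ∘ suc)) ⟩
    2ℚ ^ suc (length (deduplicate _≟_ (List.tabulate (f ∘ suc))))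
      ≡⟨ cong (2ℚ ^_) (length-deduplicate-∉ (f0∉ ∘ ∈-tabulate⁻)) ⟨
    2ℚ ^ length (deduplicate _≟_ (List.tabulate f)) ∎
    where
    N : ℚ
    N = ∑ (subsets n) (λ σ → 𝟙 (constantOnFibres? (f ∘ suc) σ))

    free : ∀ b σ → 𝟙 (constantOnFibres? f (b ∷ σ)) ≡ 𝟙 (constantOnFibres? (f ∘ suc) σ)
    free b σ = 𝟙-⇔ (tail-constant f) (extend f (λ w f0≡fw → contradiction (w , f0≡fw) f0∉))
      (constantOnFibres? f (b ∷ σ)) (constantOnFibres? (f ∘ suc) σ)

module _ (G : Graph) where
  open Graph G

  component-≡⁺ : ∀ A {u w} → Connected ends A u w → component G A u ≡ component G A w
  component-≡⁺ A {u} {w} u~w = Vec.tabulate-cong λ x → does-⇔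
    (mk⇔ (Eq.transitive (Adjacent ends A) (Eq.symmetric (Adjacent ends A) u~w))
         (Eq.transitive (Adjacent ends A) u~w))
    (connected? ends A u x) (connected? ends A w x)

  -- `w` lies in its own component, so evaluating the two equal membership vectors at `w` rules out
  -- a negative answer.
  component-≡⁻ : ∀ A {u w} → component G A u ≡ component G A w → Connected ends A u w
  component-≡⁻ A {u} {w} eq with connected? ends A u w in u?w
  ... | yes u~w = u~w
  ... | no  _   = contradiction true≡false λ ()
    where
    true≡false : true ≡ false
    true≡false = begin
      true                          ≡⟨ dec-true (connected? ends A w w) (Eq.reflexive (Adjacent ends A)) ⟨
      does (connected? ends A w w)  ≡⟨ Vec.lookup∘tabulate (λ x → does (connected? ends A w x)) w ⟨
      lookup (component G A w) w    ≡⟨ cong (λ c → lookup c w) eq ⟨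
      lookup (component G A u) w    ≡⟨ Vec.lookup∘tabulate (λ x → does (connected? ends A u x)) w ⟩
      does (connected? ends A u w)  ≡⟨ cong does u?w ⟩
      false                         ∎

  private
    _≟ᶜ_ : DecidableEquality (Subset order)
    _≟ᶜ_ = Vec.≡-dec Bool._≟_

  constantOnComponents? : (A : EdgeSet) → Decidable (ConstantOnFibres (component G A))
  constantOnComponents? A = constantOnFibres? _≟ᶜ_ (component G A)

  ∑-constantOnComponents : (A : EdgeSet) →
    ∑ (subsets order) (λ σ → 𝟙 (constantOnComponents? A σ)) ≡ 2ℚ ^ k G A
  ∑-constantOnComponents A = trans (∑-constantOnFibres _≟ᶜ_ (component G A))
    (cong (λ l → 2ℚ ^ length (deduplicate _≟ᶜ_ l)) (sym (map-tabulate (λ u → u) (component G A))))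

  monochromatic : Subset order → Edge → ℚ
  monochromatic σ e = 𝟙 (lookup σ (proj₁ (ends e)) Bool.≟ lookup σ (proj₂ (ends e)))

  -- Equality of colours is an equivalence relation, so agreement along the edges of `A` propagates
  -- through the closure that defines `Connected`; conversely, one edge is a path.
  ∏-monochromatic : (A : EdgeSet) (σ : Subset order) →
    ∏ (λ e → if lookup A e then monochromatic σ e else 1ℚ) ≡ 𝟙 (constantOnComponents? A σ)
  ∏-monochromatic A σ = begin
    ∏ (λ e → if lookup A e then monochromatic σ e else 1ℚ)
      ≡⟨ ∏-cong edge ⟩
    ∏ (λ e → 𝟙 (mono? e))
      ≡⟨ 𝟙-all? mono? ⟩
    𝟙 (Fin.all? mono?)
      ≡⟨ 𝟙-⇔ to from (Fin.all? mono?) (constantOnComponents? A σ) ⟩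
    𝟙 (constantOnComponents? A σ) ∎
    where
    Mono : Edge → Set
    Mono e = lookup A e ≡ true → lookup σ (proj₁ (ends e)) ≡ lookup σ (proj₂ (ends e))

    mono? : Decidable Mono
    mono? e = (lookup A e Bool.≟ true) →-dec (lookup σ (proj₁ (ends e)) Bool.≟ lookup σ (proj₂ (ends e)))

    edge : ∀ e → (if lookup A e then monochromatic σ e else 1ℚ) ≡ 𝟙 (mono? e)
    edge e with lookup A e
    ... | false = refl
    ... | true  with lookup σ (proj₁ (ends e)) Bool.≟ lookup σ (proj₂ (ends e))
    ...   | yes _ = refl
    ...   | no _  = refl

    to : (∀ e → Mono e) → ConstantOnFibres (component G A) σ
    to mono u w eq = Eq.gfold isEquivalence (lookup σ)
      (λ { (e , e∈A , refl) → mono e (Vec.[]=⇒lookup e∈A) }) (component-≡⁻ A eq)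

    from : ConstantOnFibres (component G A) σ → ∀ e → Mono e
    from c e e∈A = c _ _ (component-≡⁺ A (Eq.return (e , Vec.lookup⇒[]= e A e∈A , refl)))

  ∑-∏-monochromatic : (A : EdgeSet) →
    ∑ (subsets order) (λ σ → ∏ (λ e → if lookup A e then monochromatic σ e else 1ℚ)) ≡ 2ℚ ^ k G A
  ∑-∏-monochromatic A = trans (∑-cong (subsets order) (∏-monochromatic A)) (∑-constantOnComponents A)

  -- With coarser components fewer colourings are constant on them, and these numbers are the powers
  -- of 2 with exponents `k G B` and `k G A`.
  k-antitone : ∀ {A B} → (∀ {u w} → Connected ends A u w → Connected ends B u w) → k G B ℕ.≤ k G A
  k-antitone {A} {B} A⊆B = 2^-cancel-≤ (k G B) (k G A)
    (subst₂ _≤_ (∑-constantOnComponents B) (∑-constantOnComponents A)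
      (∑-mono (subsets order) λ σ → 𝟙-mono
        (λ c u w eq → c u w (component-≡⁺ B (A⊆B (component-≡⁻ A eq))))
        (constantOnComponents? B σ) (constantOnComponents? A σ)))

  k≤order : ∀ A → k G A ℕ.≤ order
  k≤order A = ℕ.≤-trans (length-deduplicate _≟ᶜ_ (List.map (component G A) (allFin order)))
    (ℕ.≤-reflexive (trans (length-map (component G A) (allFin order)) (length-tabulate (λ u → u))))

-- Evaluation of the Tutte polynomial on the hyperbola (x - 1)(y - 1) = 2

∏-if-∈ : (A : Subset n) (c : ℚ) → ∏ (λ e → if lookup A e then c else 1ℚ) ≡ c ^ ∣ A ∣
∏-if-∈ []            c = refl
∏-if-∈ (outside ∷ A) c = trans (ℚ.*-identityˡ _) (∏-if-∈ A c)
∏-if-∈ (inside ∷ A)  c = cong (c *_) (∏-if-∈ A c)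

module _ (G : Graph) where
  open Graph G

  2^r*2^k≡2^order : ∀ A → 2ℚ ^ r G A * 2ℚ ^ k G A ≡ 2ℚ ^ order
  2^r*2^k≡2^order A = ^-∸-* 2ℚ (k≤order G A)

  r-mono-⊤ : ∀ A → r G A ℕ.≤ rank G
  r-mono-⊤ A = ℕ.∸-monoʳ-≤ order
    (k-antitone G {A} {⊤} (Eq.map λ (e , _ , eq) → e , ∈⊤ , eq))

  private
    -- The product over all edges is the indicator of inclusion in `A`, written edge by edge to fit
    -- `∑-eulerian`.
    𝟙⊆ : EdgeSet → Edge → Bool → ℚ
    𝟙⊆ A e b = if b then (if lookup A e then 1ℚ else 0ℚ) else 1ℚ

  eulerianSubgraphs : EdgeSet → ℚ
  eulerianSubgraphs A = ∑ (subsets size) (λ C → 𝟙 (eulerian? G C) * ∏ (λ e → 𝟙⊆ A e (lookup C e)))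

  -- This is the size of the cycle space of (V, A), of dimension |A| - |V| + k(A). An edge of `A`
  -- contributes 1 + σ(p) σ(q), twice an indicator; any other edge contributes 1.
  2^order*eulerianSubgraphs : ∀ A → 2ℚ ^ order * eulerianSubgraphs A ≡ 2ℚ ^ ∣ A ∣ * 2ℚ ^ k G A
  2^order*eulerianSubgraphs A = begin
    2ℚ ^ order * eulerianSubgraphs A
      ≡⟨ ∑-eulerian G (𝟙⊆ A) ⟩
    ∑ (subsets order) (λ σ → ∏ (λ e → 1ℚ + (if lookup A e then 1ℚ else 0ℚ) * ss σ e))
      ≡⟨ ∑-cong (subsets order) (λ σ → trans (∏-cong (edge σ))
           (∏-* (λ e → if lookup A e then 2ℚ else 1ℚ) (λ e → if lookup A e then monochromatic G σ e else 1ℚ))) ⟩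
    ∑ (subsets order) (λ σ → ∏ (λ e → if lookup A e then 2ℚ else 1ℚ) * M σ)
      ≡⟨ *-∑ (∏ (λ e → if lookup A e then 2ℚ else 1ℚ)) (subsets order) M ⟩
    ∏ (λ e → if lookup A e then 2ℚ else 1ℚ) * ∑ (subsets order) M
      ≡⟨ cong₂ _*_ (∏-if-∈ A 2ℚ) (∑-∏-monochromatic G A) ⟩
    2ℚ ^ ∣ A ∣ * 2ℚ ^ k G A ∎
    where
    ss : Subset order → Edge → ℚ
    ss σ e = spin (lookup σ (proj₁ (ends e))) * spin (lookup σ (proj₂ (ends e)))

    M : Subset order → ℚ
    M σ = ∏ (λ e → if lookup A e then monochromatic G σ e else 1ℚ)

    edge : ∀ σ e → 1ℚ + (if lookup A e then 1ℚ else 0ℚ) * ss σ e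
           ≡ (if lookup A e then 2ℚ else 1ℚ) * (if lookup A e then monochromatic G σ e else 1ℚ)
    edge σ e with lookup A e
    ... | true  = trans (cong (_+_ 1ℚ) (ℚ.*-identityˡ (ss σ e)))
                        (spin-* (lookup σ (proj₁ (ends e))) (lookup σ (proj₂ (ends e))))
    ... | false = cong (_+_ 1ℚ) (ℚ.*-zeroˡ (ss σ e))

  -- Every character is 1 on the empty set, so the character sum settles this without computing
  -- degrees.
  𝟙-eulerian-⊥ : 𝟙 (eulerian? G ⊥) ≡ 1ℚ
  𝟙-eulerian-⊥ = *-cancelˡ-≡-pos (2ℚ ^ order) {{^-pos 2ℚ order}} (begin
    2ℚ ^ order * 𝟙 (eulerian? G ⊥)
      ≡⟨ 𝟙-eulerian G ⊥ ⟩
    ∑ (subsets order) (λ σ → ∏ (λ w → spin (lookup σ w) ^ degree G ⊥ w))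
      ≡⟨ ∑-cong (subsets order) (λ σ → trans (∏-^-degree G (λ w → spin (lookup σ w)) ⊥)
           (trans (∏-cong λ e → cong (if_then spin (lookup σ (proj₁ (ends e))) * spin (lookup σ (proj₂ (ends e))) else 1ℚ)
                                     (Vec.lookup-replicate e outside))
                  (∏-1 size))) ⟩
    ∑ (subsets order) (λ _ → 1ℚ)
      ≡⟨ ∑-subsets-const order 1ℚ ⟩
    2ℚ ^ order * 1ℚ ∎)

  1≤eulerianSubgraphs : ∀ A → 1ℚ ≤ eulerianSubgraphs A
  1≤eulerianSubgraphs A = subst (_≤ eulerianSubgraphs A)
    (cong₂ _*_ 𝟙-eulerian-⊥ (trans (∏-cong λ e → cong (𝟙⊆ A e) (Vec.lookup-replicate e outside)) (∏-1 size)))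
    (term≤∑ {f = term} nonNegative (∈-subsets ⊥))
    where
    term : EdgeSet → ℚ
    term C = 𝟙 (eulerian? G C) * ∏ (λ e → 𝟙⊆ A e (lookup C e))

    0≤𝟙⊆ : ∀ e b → 0ℚ ≤ 𝟙⊆ A e b
    0≤𝟙⊆ e false = ℚ.nonNegative⁻¹ 1ℚ
    0≤𝟙⊆ e true  with lookup A e
    ... | true  = ℚ.nonNegative⁻¹ 1ℚ
    ... | false = ℚ.≤-refl

    nonNegative : ∀ C → 0ℚ ≤ term C
    nonNegative C = ℚ.nonNegative⁻¹ (term C) {{ℚ.nonNeg*nonNeg⇒nonNeg
      (𝟙 (eulerian? G C)) {{ℚ.nonNegative (0≤𝟙 (eulerian? G C))}}
      (∏ (λ e → 𝟙⊆ A e (lookup C e))) {{ℚ.nonNegative (0≤∏ λ e → 0≤𝟙⊆ e (lookup C e))}}}}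

  -- The empty set is an eulerian subset of `A`, so the count is at least 1 and 2^|V| ≤ 2^(k(A) +
  -- |A|).
  r≤∣∣ : ∀ A → r G A ℕ.≤ ∣ A ∣
  r≤∣∣ A = ℕ.m≤n+o⇒m∸n≤o order (k G A) (2^-cancel-≤ order (k G A ℕ.+ ∣ A ∣)
    (subst₂ _≤_ (ℚ.*-identityʳ (2ℚ ^ order))
      (trans (2^order*eulerianSubgraphs A)
        (trans (ℚ.*-comm (2ℚ ^ ∣ A ∣) (2ℚ ^ k G A)) (sym (^-homo-* 2ℚ (k G A) ∣ A ∣))))
      (ℚ.*-monoˡ-≤-nonNeg (2ℚ ^ order) {{ℚ.pos⇒nonNeg (2ℚ ^ order) {{^-pos 2ℚ order}}}}
        (1≤eulerianSubgraphs A))))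

  rank≤size : rank G ℕ.≤ size
  rank≤size = subst (rank G ℕ.≤_) (∣⊤∣≡n size) (r≤∣∣ ⊤)

  2^rank*eulerian : 2ℚ ^ rank G * ∑ (subsets size) (λ C → 𝟙 (eulerian? G C)) ≡ 2ℚ ^ size
  2^rank*eulerian = *-cancelˡ-≡-pos (2ℚ ^ k G ⊤) {{^-pos 2ℚ (k G ⊤)}} (begin
    2ℚ ^ k G ⊤ * (2ℚ ^ rank G * N)
      ≡⟨ solve 3 (λ a b c → a :* (b :* c) := b :* a :* c) refl (2ℚ ^ k G ⊤) (2ℚ ^ rank G) N ⟩
    2ℚ ^ rank G * 2ℚ ^ k G ⊤ * N
      ≡⟨ cong₂ _*_ (2^r*2^k≡2^order ⊤) (∑-cong (subsets size) all⊆⊤) ⟩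
    2ℚ ^ order * eulerianSubgraphs ⊤
      ≡⟨ 2^order*eulerianSubgraphs ⊤ ⟩
    2ℚ ^ ∣ ⊤ {size} ∣ * 2ℚ ^ k G ⊤
      ≡⟨ cong (λ m → 2ℚ ^ m * 2ℚ ^ k G ⊤) (∣⊤∣≡n size) ⟩
    2ℚ ^ size * 2ℚ ^ k G ⊤
      ≡⟨ ℚ.*-comm (2ℚ ^ size) (2ℚ ^ k G ⊤) ⟩
    2ℚ ^ k G ⊤ * 2ℚ ^ size ∎)
    where
    N : ℚ
    N = ∑ (subsets size) (λ C → 𝟙 (eulerian? G C))

    1⊆ : ∀ e b → 𝟙⊆ ⊤ e b ≡ 1ℚ
    1⊆ e false = refl
    1⊆ e true  = cong (if_then 1ℚ else 0ℚ) (Vec.lookup-replicate e inside)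

    all⊆⊤ : ∀ C → 𝟙 (eulerian? G C) ≡ 𝟙 (eulerian? G C) * ∏ (λ e → 𝟙⊆ ⊤ e (lookup C e))
    all⊆⊤ C = trans (sym (ℚ.*-identityʳ (𝟙 (eulerian? G C))))
      (cong (𝟙 (eulerian? G C) *_) (sym (trans (∏-cong λ e → 1⊆ e (lookup C e)) (∏-1 size))))

  eulerianSum : ℚ
  eulerianSum = ∑ (subsets size) (λ C → 𝟙 (eulerian? G C) * ∏ (λ e → differenceWeight (lookup C e)))

  private
    -- For x = -2 and y = 1/3, `-3ℚ` is x - 1 and `-⅔` is y - 1.
    -⅔ -3ℚ -2ℚ : ℚ
    -⅔  = -[1+ 1 ] / 3
    -3ℚ = -[1+ 2 ] / 1
    -2ℚ = -[1+ 1 ] / 1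

  2^order*eulerianSum :
    2ℚ ^ order * eulerianSum ≡ 3ℚ ^ size * ∑ (subsets size) (λ A → -⅔ ^ ∣ A ∣ * 2ℚ ^ k G A)
  2^order*eulerianSum = begin
    2ℚ ^ order * eulerianSum
      ≡⟨ ∑-eulerian G (λ _ → differenceWeight) ⟩
    ∑ (subsets order) (λ σ → ∏ (λ e → 2ℚ + - 1ℚ * (spin (lookup σ (p e)) * spin (lookup σ (q e)))))
      ≡⟨ ∑-cong (subsets order) (λ σ → trans (∏-cong λ e → edge (lookup σ (p e)) (lookup σ (q e)))
           (trans (∏-* (λ _ → 3ℚ) (λ e → 1ℚ + -⅔ * mono σ e))
                  (cong (_* ∏ (λ e → 1ℚ + -⅔ * mono σ e)) (∏-const size 3ℚ)))) ⟩
    ∑ (subsets order) (λ σ → 3ℚ ^ size * ∏ (λ e → 1ℚ + -⅔ * mono σ e))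
      ≡⟨ *-∑ (3ℚ ^ size) (subsets order) (λ σ → ∏ (λ e → 1ℚ + -⅔ * mono σ e)) ⟩
    3ℚ ^ size * ∑ (subsets order) (λ σ → ∏ (λ e → 1ℚ + -⅔ * mono σ e))
      ≡⟨ cong (3ℚ ^ size *_) (∑-cong (subsets order) λ σ →
           sym (∑-∏ size (λ e b → if b then -⅔ * mono σ e else 1ℚ))) ⟩
    3ℚ ^ size * ∑ (subsets order) (λ σ → ∑ (subsets size) (term σ))
      ≡⟨ cong (3ℚ ^ size *_) (∑-comm (subsets order) (subsets size) term) ⟩
    3ℚ ^ size * ∑ (subsets size) (λ A → ∑ (subsets order) (λ σ → term σ A))
      ≡⟨ cong (3ℚ ^ size *_) (∑-cong (subsets size) inner) ⟩
    3ℚ ^ size * ∑ (subsets size) (λ A → -⅔ ^ ∣ A ∣ * 2ℚ ^ k G A) ∎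
    where
    p q : Edge → Vertex
    p e = proj₁ (ends e)
    q e = proj₂ (ends e)

    mono : Subset order → Edge → ℚ
    mono = monochromatic G

    term : Subset order → EdgeSet → ℚ
    term σ A = ∏ (λ e → if lookup A e then -⅔ * mono σ e else 1ℚ)

    -- The weight is 1 on an edge with equally coloured ends and 3 otherwise. Taking out the 3
    -- leaves 1/3 = 1 - 2/3 on the former, which is where y - 1 appears.
    edge : ∀ a b → 2ℚ + - 1ℚ * (spin a * spin b) ≡ 3ℚ * (1ℚ + -⅔ * 𝟙 (a Bool.≟ b))
    edge false false = refl
    edge false true  = refl
    edge true  false = refl
    edge true  true  = refl

    if-* : ∀ b x y → (if b then x * y else 1ℚ) ≡ (if b then x else 1ℚ) * (if b then y else 1ℚ)
    if-* false x y = refl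
    if-* true  x y = refl

    inner : ∀ A → ∑ (subsets order) (λ σ → term σ A)
                  ≡ -⅔ ^ ∣ A ∣ * 2ℚ ^ k G A
    inner A = begin
      ∑ (subsets order) (λ σ → term σ A)
        ≡⟨ ∑-cong (subsets order) (λ σ → trans (∏-cong λ e → if-* (lookup A e) -⅔ (mono σ e))
             (trans (∏-* (λ e → if lookup A e then -⅔ else 1ℚ) (λ e → if lookup A e then mono σ e else 1ℚ))
                    (cong (_* ∏ (λ e → if lookup A e then mono σ e else 1ℚ)) (∏-if-∈ A -⅔)))) ⟩
      ∑ (subsets order) (λ σ → -⅔ ^ ∣ A ∣ * ∏ (λ e → if lookup A e then mono σ e else 1ℚ))
        ≡⟨ *-∑ (-⅔ ^ ∣ A ∣) (subsets order) (λ σ → ∏ (λ e → if lookup A e then mono σ e else 1ℚ)) ⟩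
      -⅔ ^ ∣ A ∣ * ∑ (subsets order) (λ σ → ∏ (λ e → if lookup A e then mono σ e else 1ℚ))
        ≡⟨ cong (-⅔ ^ ∣ A ∣ *_) (∑-∏-monochromatic G A) ⟩
      -⅔ ^ ∣ A ∣ * 2ℚ ^ k G A ∎

  2^order*tutte : 2ℚ ^ order * tutte G -2ℚ (+ 1 / 3)
                  ≡ -3ℚ ^ rank G * ∑ (subsets size) (λ A → -⅔ ^ ∣ A ∣ * 2ℚ ^ k G A)
  2^order*tutte = begin
    2ℚ ^ order * ∑ (subsets size) term
      ≡⟨ *-∑ (2ℚ ^ order) (subsets size) term ⟨
    ∑ (subsets size) (λ A → 2ℚ ^ order * term A)
      ≡⟨ ∑-cong (subsets size) scale ⟩
    ∑ (subsets size) (λ A → -3ℚ ^ rank G * (-⅔ ^ ∣ A ∣ * 2ℚ ^ k G A))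
      ≡⟨ *-∑ (-3ℚ ^ rank G) (subsets size) (λ A → -⅔ ^ ∣ A ∣ * 2ℚ ^ k G A) ⟩
    -3ℚ ^ rank G * ∑ (subsets size) (λ A → -⅔ ^ ∣ A ∣ * 2ℚ ^ k G A) ∎
    where
    term : EdgeSet → ℚ
    term A = -3ℚ ^ (rank G ∸ r G A) * -⅔ ^ (∣ A ∣ ∸ r G A)

    scale : ∀ A → 2ℚ ^ order * term A ≡ -3ℚ ^ rank G * (-⅔ ^ ∣ A ∣ * 2ℚ ^ k G A)
    scale A = begin
      2ℚ ^ order * (x * y)
        ≡⟨ cong (_* (x * y)) (2^r*2^k≡2^order A) ⟨
      2ℚ ^ r G A * 2ℚ ^ k G A * (x * y)
        -- The equation of the hyperbola enters here: 2 = (-3)(-2/3) supplies the powers that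
        -- complete both truncated exponents, to `rank G` and to `∣ A ∣`.
        ≡⟨ cong (λ t → t * 2ℚ ^ k G A * (x * y)) (^-distrib-* -3ℚ -⅔ (r G A)) ⟩
      -3ℚ ^ r G A * -⅔ ^ r G A * 2ℚ ^ k G A * (x * y)
        ≡⟨ solve 5 (λ a b c x y → a :* b :* c :* (x :* y) := (x :* a) :* ((y :* b) :* c)) refl
             (-3ℚ ^ r G A) (-⅔ ^ r G A) (2ℚ ^ k G A) x y ⟩
      (x * -3ℚ ^ r G A) * ((y * -⅔ ^ r G A) * 2ℚ ^ k G A)
        ≡⟨ cong₂ (λ a b → a * (b * 2ℚ ^ k G A)) (^-∸-* -3ℚ (r-mono-⊤ A)) (^-∸-* -⅔ (r≤∣∣ A)) ⟩
      -3ℚ ^ rank G * (-⅔ ^ ∣ A ∣ * 2ℚ ^ k G A) ∎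
      where
      x y : ℚ
      x = -3ℚ ^ (rank G ∸ r G A)
      y = -⅔ ^ (∣ A ∣ ∸ r G A)

  -- The prefactor is what clears the powers: (-2)^r (-3)^r = 2^r 3^r removes the sign, and the 3^r
  -- joins 3^n to give 3^|E|.
  tutte-eulerianSum :
    -2ℚ ^ rank G * 3ℚ ^ nullity G * tutte G -2ℚ (+ 1 / 3) ≡ 2ℚ ^ rank G * eulerianSum
  tutte-eulerianSum = *-cancelˡ-≡-pos (2ℚ ^ order) {{^-pos 2ℚ order}} (begin
    2ℚ ^ order * (-2ℚ ^ rank G * 3ℚ ^ nullity G * T)
      ≡⟨ solve 4 (λ o a b t → o :* (a :* b :* t) := a :* b :* (o :* t)) refl
           (2ℚ ^ order) (-2ℚ ^ rank G) (3ℚ ^ nullity G) T ⟩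
    -2ℚ ^ rank G * 3ℚ ^ nullity G * (2ℚ ^ order * T)
      ≡⟨ cong (_*_ (-2ℚ ^ rank G * 3ℚ ^ nullity G)) 2^order*tutte ⟩
    -2ℚ ^ rank G * 3ℚ ^ nullity G * (-3ℚ ^ rank G * Z)
      ≡⟨ solve 4 (λ a b c z → a :* b :* (c :* z) := (a :* c) :* (b :* z)) refl
           (-2ℚ ^ rank G) (3ℚ ^ nullity G) (-3ℚ ^ rank G) Z ⟩
    (-2ℚ ^ rank G * -3ℚ ^ rank G) * (3ℚ ^ nullity G * Z)
      ≡⟨ cong (_* (3ℚ ^ nullity G * Z)) (trans (sym (^-distrib-* -2ℚ -3ℚ (rank G)))
                                              (^-distrib-* 2ℚ 3ℚ (rank G))) ⟩
    (2ℚ ^ rank G * 3ℚ ^ rank G) * (3ℚ ^ nullity G * Z)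
      ≡⟨ solve 4 (λ a b c z → (a :* b) :* (c :* z) := a :* ((c :* b) :* z)) refl
           (2ℚ ^ rank G) (3ℚ ^ rank G) (3ℚ ^ nullity G) Z ⟩
    2ℚ ^ rank G * (3ℚ ^ nullity G * 3ℚ ^ rank G * Z)
      ≡⟨ cong (λ t → 2ℚ ^ rank G * (t * Z)) (^-∸-* 3ℚ rank≤size) ⟩
    2ℚ ^ rank G * (3ℚ ^ size * Z)
      ≡⟨ cong (2ℚ ^ rank G *_) 2^order*eulerianSum ⟨
    2ℚ ^ rank G * (2ℚ ^ order * eulerianSum)
      ≡⟨ solve 3 (λ a o s → a :* (o :* s) := o :* (a :* s)) refl (2ℚ ^ rank G) (2ℚ ^ order) eulerianSum ⟩
    2ℚ ^ order * (2ℚ ^ rank G * eulerianSum) ∎)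
    where
    T Z : ℚ
    T = tutte G -2ℚ (+ 1 / 3)
    Z = ∑ (subsets size) (λ A → -⅔ ^ ∣ A ∣ * 2ℚ ^ k G A)

-- The biases and their quotient

module _ (G : Graph) where
  open Graph G

  -- Among the 4^m outcomes, each of the 2^(m-r) eulerian sets arises 2^m times.
  1/ℙΔ≡2^rank : (1/ ℙ (Δ? G)) {{ℙΔ≢0 G}} ≡ 2ℚ ^ rank G
  1/ℙΔ≡2^rank = begin
    κ
      ≡⟨ ℚ.*-identityʳ κ ⟨
    κ * 1ℚ
      ≡⟨ cong (κ *_) ℙΔ*2^rank ⟨
    κ * (ℙ (Δ? G) * 2ℚ ^ rank G)
      ≡⟨ ℚ.*-assoc κ (ℙ (Δ? G)) (2ℚ ^ rank G) ⟨
    κ * ℙ (Δ? G) * 2ℚ ^ rank G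
      ≡⟨ cong (_* 2ℚ ^ rank G) (ℚ.*-inverseˡ (ℙ (Δ? G)) {{ℙΔ≢0 G}}) ⟩
    1ℚ * 2ℚ ^ rank G
      ≡⟨ ℚ.*-identityˡ (2ℚ ^ rank G) ⟩
    2ℚ ^ rank G ∎
    where
    κ N : ℚ
    κ = (1/ ℙ (Δ? G)) {{ℙΔ≢0 G}}
    N = ∑ (subsets size) (λ C → 𝟙 (eulerian? G C))

    ℙΔ*2^rank : ℙ (Δ? G) * 2ℚ ^ rank G ≡ 1ℚ
    ℙΔ*2^rank = begin
      ℙ (Δ? G) * 2ℚ ^ rank G
        ≡⟨ cong (_* 2ℚ ^ rank G) (trans (ℙ-∑ (Δ? G))
             (cong (pointMass size *_) (∑-outcomes-△ size (λ C → 𝟙 (eulerian? G C))))) ⟩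
      pointMass size * (2ℚ ^ size * N) * 2ℚ ^ rank G
        ≡⟨ solve 4 (λ c m e r → c :* (m :* e) :* r := m :* (r :* e) :* c) refl
             (pointMass size) (2ℚ ^ size) N (2ℚ ^ rank G) ⟩
      2ℚ ^ size * (2ℚ ^ rank G * N) * pointMass size
        ≡⟨ cong (λ t → 2ℚ ^ size * t * pointMass size) (2^rank*eulerian G) ⟩
      2ℚ ^ size * 2ℚ ^ size * pointMass size
        ≡⟨ pointMass-total size ⟩
      1ℚ ∎

  Bias∣Δ-contrast : ∀ i j →
    Bias[_∣Δ] G (sizesDifferMod3? i) - Bias[_∣Δ] G (sizesDifferMod3? j)
      ≡ 2ℚ * pointMass size * (2ℚ ^ rank G * (eulerianSum G * contrast i j 0 0))
  Bias∣Δ-contrast i j = trans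
    (Bias∣-difference (Δ? G) {{ℙΔ≢0 G}} (sizesDifferMod3? i) (sizesDifferMod3? j))
    (cong (_*_ (2ℚ * pointMass size))
      (cong₂ _*_ 1/ℙΔ≡2^rank (∑-outcomes-balanced (contrast-balanced i j) size (λ C → 𝟙 (eulerian? G C)))))

-- Without conditioning the sum over `C` factors over the edges, and each factor is 2 + (-1) = 1.
Bias-contrast : ∀ n → Bias {n} (sizesDifferMod3? 0) - Bias {n} (sizesDifferMod3? 1) ≡ 2ℚ * pointMass n
Bias-contrast n = begin
  Bias {n} (sizesDifferMod3? 0) - Bias {n} (sizesDifferMod3? 1)
    ≡⟨ Bias-difference {n} (sizesDifferMod3? 0) (sizesDifferMod3? 1) ⟩
  2ℚ * pointMass n * ∑ (outcomes n) (λ (A , B) → contrast 0 1 ∣ A ∣ ∣ B ∣)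
    ≡⟨ cong (_*_ (2ℚ * pointMass n)) (trans
         (∑-cong (outcomes n) (λ (A , B) → sym (ℚ.*-identityˡ (contrast 0 1 ∣ A ∣ ∣ B ∣))))
         (∑-outcomes-balanced (contrast-balanced 0 1) n (λ _ → 1ℚ))) ⟩
  2ℚ * pointMass n * (∑ (subsets n) (λ C → 1ℚ * ∏ (λ e → differenceWeight (lookup C e))) * 1ℚ)
    ≡⟨ cong (λ t → 2ℚ * pointMass n * (t * 1ℚ)) (trans
         (∑-cong (subsets n) (λ C → ℚ.*-identityˡ (∏ (λ e → differenceWeight (lookup C e)))))
         (trans (∑-∏ n (λ _ → differenceWeight)) (∏-1 n))) ⟩
  2ℚ * pointMass n * 1ℚ
    ≡⟨ ℚ.*-identityʳ (2ℚ * pointMass n) ⟩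
  2ℚ * pointMass n ∎

2*pointMass-pos : ∀ n → Positive (2ℚ * pointMass n)
2*pointMass-pos n = ℚ.pos*pos⇒pos 2ℚ (pointMass n)
  {{ℚ.normalize-pos 1 (length (outcomes n)) {{∣outcomes∣≢0 n}}}}

theorem2p14 : (G : Graph) →
    let open Graph G
        sizesDiffer? = sizesDifferMod3? {size}
        -2ℚ = -[1+ 1 ] / 1
        3ℚ = + 3 / 1
        ⅓ℚ = + 1 / 3
        numerator = Bias[_∣Δ] G (sizesDiffer? 0) - Bias[_∣Δ] G (sizesDiffer? 1)
        denominator = Bias (sizesDiffer? 0) - Bias (sizesDiffer? 1)
    in
    (Bias[_∣Δ] G (sizesDiffer? 1) ≡ Bias[_∣Δ] G (sizesDiffer? 2))
    × Σ (NonZero denominator) (λ nz →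
        _÷_ numerator denominator {{nz}}
          ≡ -2ℚ ^ rank G * 3ℚ ^ nullity G * tutte G -2ℚ ⅓ℚ)
theorem2p14 G = equal , nonZero , ratio
  where
  open Graph G

  β : ℕ → ℚ
  β i = Bias[_∣Δ] G (sizesDifferMod3? i)

  c d S : ℚ
  c = 2ℚ * pointMass size
  d = Bias {size} (sizesDifferMod3? 0) - Bias {size} (sizesDifferMod3? 1)
  S = eulerianSum G

  equal : β 1 ≡ β 2
  equal = begin
    β 1
      ≡⟨ solve 2 (λ x y → x := (x :- y) :+ y) refl (β 1) (β 2) ⟩
    (β 1 - β 2) + β 2
      ≡⟨ cong (_+ β 2) (Bias∣Δ-contrast G 1 2) ⟩
    -- `contrast 1 2 0 0` computes to 0: the difference 0 has neither residue 1 nor residue 2.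
    c * (2ℚ ^ rank G * (S * 0ℚ)) + β 2
      ≡⟨ solve 4 (λ c r s b → c :* (r :* (s :* con 0ℚ)) :+ b := b) refl c (2ℚ ^ rank G) S (β 2) ⟩
    β 2 ∎

  nonZero : NonZero d
  nonZero = subst NonZero (sym (Bias-contrast size)) (ℚ.pos⇒nonZero c {{2*pointMass-pos size}})

  ratio : _÷_ (β 0 - β 1) d {{nonZero}}
          ≡ (-[1+ 1 ] / 1) ^ rank G * 3ℚ ^ nullity G * tutte G (-[1+ 1 ] / 1) (+ 1 / 3)
  ratio = begin
    (β 0 - β 1) * d⁻¹
      ≡⟨ cong (_* d⁻¹) (Bias∣Δ-contrast G 0 1) ⟩
    c * (2ℚ ^ rank G * (S * 1ℚ)) * d⁻¹
      -- `c` is the value of the denominator; reading it as `d` again lets it cancel against `d⁻¹`.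
      ≡⟨ cong (λ t → t * (2ℚ ^ rank G * (S * 1ℚ)) * d⁻¹) (Bias-contrast size) ⟨
    d * (2ℚ ^ rank G * (S * 1ℚ)) * d⁻¹
      ≡⟨ solve 4 (λ d r s i → d :* (r :* (s :* con 1ℚ)) :* i := d :* i :* (r :* s)) refl d (2ℚ ^ rank G) S d⁻¹ ⟩
    d * d⁻¹ * (2ℚ ^ rank G * S)
      ≡⟨ cong (_* (2ℚ ^ rank G * S)) (ℚ.*-inverseʳ d {{nonZero}}) ⟩
    1ℚ * (2ℚ ^ rank G * S)
      ≡⟨ ℚ.*-identityˡ (2ℚ ^ rank G * S) ⟩
    2ℚ ^ rank G * S
      ≡⟨ tutte-eulerianSum G ⟨
    (-[1+ 1 ] / 1) ^ rank G * 3ℚ ^ nullity G * tutte G (-[1+ 1 ] / 1) (+ 1 / 3) ∎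
    where
    d⁻¹ : ℚ
    d⁻¹ = (1/ d) {{nonZero}}
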